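{- For any finite graph $G$ we have $\alpha(G[k])=O\left(k^{\alpha(G)-1}\right)$ as $k\to\infty$; that is, there is a constant $C$ depending only on $G$ such that $\alpha(G[k])\leq C\,k^{\alpha(G)-1}$ for all integers $k\geq 1$.
   Context: Graphs are finite, simple and undirected; $\alpha(\cdot)$ denotes the independence number (the maximum size of a set of pairwise non-adjacent vertices). For a finite graph $G$ with vertex set $V$ and $k\in\mathbb{N}$, the graph $G[k]$ is defined as follows. Its vertices are the configurations of $k$ identical pebbles on the vertices of $G$, i.e. the functions $f:V\to\mathbb{Z}_{\geq 0}$ with $\sum_{v\in V} f(v)=k$. Two distinct configurations $f$ and $g$ are adjacent in $G[k]$ if $g$ can be obtained from $f$ by (simultaneously) moving some of the pebbles, each moved pebble going to a neighbour in $G$ of the vertex it lies on; that is, if there are maps $\varphi,\gamma:\{1,\dots,k\}\to V$ with $|\varphi^{ -1}(v)|=f(v)$ and $|\gamma^{ -1}(v)|=g(v)$ for all $v\in V$, such that for every $i$ either $\varphi(i)=\gamma(i)$ or $\varphi(i)$ and $\gamma(i)$ are adjacent in $G$. (Equivalently, $G[k]$ is the quotient of the $k$-fold strong power $G^{\boxtimes k}$ by the action of the symmetric group $S_k$ permuting coordinates.) -}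

module Defs where

open import Data.Fin using (Fin; finToFun; funToFin)
open import Data.Fin.Properties using (0↔⊥; 1↔⊤; +↔⊎; inj⇒≟; any?; all?; finToFun-funToFin)
open import Data.Fin.Subset using (Subset; inside; outside; ⊥; _∈_; ∣_∣)
import Data.Fin.Subset.Properties as Subsetₚ
open import Data.List using (List; []; _∷_; map; _++_; filter)
import Data.List.Extrema.Nat as Extrema
import Data.List.Membership.Propositional as List
open import Data.List.Membership.Propositional.Properties
  using (∈-map⁺; ∈-map⁻; ∈-++⁺ˡ; ∈-++⁺ʳ; ∈-filter⁺; ∈-filter⁻)
import Data.List.Relation.Unary.All as All
open import Data.List.Relation.Unary.Any using (here)
open import Data.Nat using (ℕ; zero; suc; _+_; _^_; _≤_)
import Data.Nat.Properties as ℕₚ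
open import Data.Product using (Σ-syntax; ∃; ∃-syntax; _×_; _,_; proj₁; proj₂)
open import Data.Sum using (_⊎_; inj₁; inj₂)
open import Data.Sum.Function.Propositional using (_⊎-↔_)
open import Data.Unit using (tt)
open import Data.Vec using (Vec; []; _∷_; lookup; tabulate; count; sum)
open import Data.Vec.Properties using (tabulate-cong)
open import Function using (_∘_; _↔_; mk↔ₛ′; Inverse)
open import Function.Properties.Inverse using (↔⇒↣; ↔-sym; ↔-trans)
open import Relation.Binary using (Decidable; DecidableEquality)
open import Relation.Binary.PropositionalEquality
open import Relation.Nullary using (¬_; Dec)
open import Relation.Nullary.Decidable using (map′; _×-dec_; _⊎-dec_; _→-dec_; ¬?)

record Graph : Set₁ where
  infix 4 _~_ _~?_
  field
    V           : Set
    order       : ℕ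
    enumeration : V ↔ Fin order
    _~_         : V → V → Set
    ~-sym       : ∀ {u v} → u ~ v → v ~ u
    ~-irrefl    : ∀ {v} → ¬ (v ~ v)
    _~?_        : Decidable _~_

  index : V → Fin order
  index = Inverse.to enumeration

  vertex : Fin order → V
  vertex = Inverse.from enumeration

  vertex-index : ∀ v → vertex (index v) ≡ v
  vertex-index = Inverse.strictlyInverseʳ enumeration

  _≟_ : DecidableEquality V
  _≟_ = inj⇒≟ (↔⇒↣ enumeration)

  all-vertices? : {P : V → Set} → (∀ v → Dec (P v)) → Dec (∀ v → P v)
  all-vertices? {P} P? =
    map′ (λ p v → subst P (vertex-index v) (p (index v))) (λ p i → p (vertex i))
         (all? (P? ∘ vertex))

  -- Without function extensionality, a search over the maps Fin k → V is only
  -- complete for predicates respecting pointwise equality.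
  any-map? : ∀ {k} {P : (Fin k → V) → Set} →
             (∀ {φ ψ} → φ ≗ ψ → P φ → P ψ) →
             (∀ φ → Dec (P φ)) → Dec (∃ P)
  any-map? {k} {P} resp P? =
    map′ (λ (c , p) → decode c , p)
         (λ (φ , p) → encode φ , resp (sym ∘ decode-encode φ) p)
         (any? (P? ∘ decode))
    where
    decode : Fin (order ^ k) → Fin k → V
    decode c = vertex ∘ finToFun c
    encode : (Fin k → V) → Fin (order ^ k)
    encode φ = funToFin (index ∘ φ)
    decode-encode : ∀ φ → decode (encode φ) ≗ φ
    decode-encode φ i =
      trans (cong vertex (finToFun-funToFin (index ∘ φ) i)) (vertex-index (φ i))

subsets : ∀ n → List (Subset n)
subsets zero    = [] ∷ []
subsets (suc n) = map (inside ∷_) (subsets n) ++ map (outside ∷_) (subsets n)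

∈-subsets : ∀ {n} (S : Subset n) → S List.∈ subsets n
∈-subsets []            = here refl
∈-subsets (inside  ∷ S) = ∈-++⁺ˡ (∈-map⁺ (inside ∷_) (∈-subsets S))
∈-subsets (outside ∷ S) =
  ∈-++⁺ʳ (map (inside ∷_) (subsets _)) (∈-map⁺ (outside ∷_) (∈-subsets S))

module _ (G : Graph) where
  open Graph G

  -- Sets of vertices are given by the indices of their elements.
  Independent : Subset order → Set
  Independent S = ∀ i j → i ∈ S → j ∈ S → ¬ (vertex i ~ vertex j)

  independent? : ∀ S → Dec (Independent S)
  independent? S = all? λ i → all? λ j →
    (i Subsetₚ.∈? S) →-dec ((j Subsetₚ.∈? S) →-dec ¬? (vertex i ~? vertex j))

  -- The default value 0 is the size of the empty set, which is independent.
  α : ℕ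
  α = Extrema.max 0 (map ∣_∣ (filter independent? (subsets order)))

  α-upper : ∀ {S} → Independent S → ∣ S ∣ ≤ α
  α-upper {S} ind =
    All.lookup (Extrema.xs≤max 0 _) (∈-map⁺ ∣_∣ (∈-filter⁺ independent? (∈-subsets S) ind))

  α-attained : ∃[ S ] Independent S × ∣ S ∣ ≡ α
  α-attained with Extrema.argmax-sel (λ m → m) 0 (map ∣_∣ (filter independent? (subsets order)))
  ... | inj₁ α≡0 = ⊥ , (λ i j i∈⊥ _ _ → Subsetₚ.∉⊥ i∈⊥)
                 , trans (Subsetₚ.∣⊥∣≡0 order) (sym α≡0)
  ... | inj₂ α∈  with ∈-map⁻ ∣_∣ α∈
  ...   | S , S∈ , α≡∣S∣ = S , proj₂ (∈-filter⁻ independent? {xs = subsets order} S∈) , sym α≡∣S∣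

-- Vectors rather than functions, so that _≡_ is equality of configurations.
Config : ℕ → ℕ → Set
Config n k = Σ[ f ∈ Vec ℕ n ] sum f ≡ k

Config-≡ : ∀ {n k} {f g : Config n k} → proj₁ f ≡ proj₁ g → f ≡ g
Config-≡ {f = f , p} {.f , q} refl = cong (f ,_) (ℕₚ.≡-irrelevant p q)

numConfigs : ℕ → ℕ → ℕ
numConfigs zero    zero    = 1
numConfigs zero    (suc k) = 0
numConfigs (suc n) zero    = numConfigs n zero
numConfigs (suc n) (suc k) = numConfigs n (suc k) + numConfigs (suc n) k

Config-enumeration : ∀ n k → Config n k ↔ Fin (numConfigs n k)
Config-enumeration zero zero =
  ↔-trans (mk↔ₛ′ (λ _ → tt) (λ _ → [] , refl) (λ _ → refl) λ { ([] , _) → Config-≡ refl })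
          (↔-sym 1↔⊤)
Config-enumeration zero (suc k) =
  ↔-trans (mk↔ₛ′ (λ { ([] , ()) }) (λ ()) (λ ()) λ { ([] , ()) }) (↔-sym 0↔⊥)
Config-enumeration (suc n) zero =
  ↔-trans (mk↔ₛ′ to from (λ _ → refl) from-to) (Config-enumeration n zero)
  where
  to : Config (suc n) zero → Config n zero
  to (zero  ∷ f , p) = f , p
  to (suc _ ∷ _ , ())
  from : Config n zero → Config (suc n) zero
  from (f , p) = zero ∷ f , p
  from-to : ∀ x → from (to x) ≡ x
  from-to (zero  ∷ f , p) = refl
  from-to (suc _ ∷ _ , ())
Config-enumeration (suc n) (suc k) =
  ↔-trans (mk↔ₛ′ to from to-from from-to)
          (↔-trans (Config-enumeration n (suc k) ⊎-↔ Config-enumeration (suc n) k)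
                   (↔-sym +↔⊎))
  where
  to : Config (suc n) (suc k) → Config n (suc k) ⊎ Config (suc n) k
  to (zero  ∷ f , p) = inj₁ (f , p)
  to (suc m ∷ f , p) = inj₂ (m ∷ f , ℕₚ.suc-injective p)
  from : Config n (suc k) ⊎ Config (suc n) k → Config (suc n) (suc k)
  from (inj₁ (f , p))     = zero ∷ f , p
  from (inj₂ (m ∷ f , p)) = suc m ∷ f , cong suc p
  to-from : ∀ x → to (from x) ≡ x
  to-from (inj₁ _)           = refl
  to-from (inj₂ (m ∷ f , p)) = cong inj₂ (Config-≡ refl)
  from-to : ∀ x → from (to x) ≡ x
  from-to (zero  ∷ f , p) = refl
  from-to (suc m ∷ f , p) = Config-≡ refl

module _ (G : Graph) where
  open Graph G

  pebblesAt : ∀ {k} → Config order k → V → ℕ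
  pebblesAt (f , _) v = lookup f (index v)

  fibreSize : ∀ {k} → (Fin k → V) → V → ℕ
  fibreSize φ v = count (_≟ v) (tabulate φ)

  -- φ lists the positions of k labelled pebbles forming the configuration f.
  Labels : ∀ {k} → (Fin k → V) → Config order k → Set
  Labels φ f = ∀ v → fibreSize φ v ≡ pebblesAt f v

  Reachable : ∀ {k} → Config order k → Config order k → Set
  Reachable {k} f g =
    Σ[ φ ∈ (Fin k → V) ] Σ[ γ ∈ (Fin k → V) ]
      Labels φ f × Labels γ g × (∀ i → φ i ≡ γ i ⊎ φ i ~ γ i)

  reachable-sym : ∀ {k} (f g : Config order k) → Reachable f g → Reachable g f
  reachable-sym {k} _ _ (φ , γ , φf , γg , step) = γ , φ , γg , φf , step′
    where
    step′ : ∀ i → γ i ≡ φ i ⊎ γ i ~ φ i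
    step′ i with step i
    ... | inj₁ φi≡γi = inj₁ (sym φi≡γi)
    ... | inj₂ φi~γi = inj₂ (~-sym φi~γi)

  labels-resp : ∀ {k} {f : Config order k} {φ ψ : Fin k → V} → φ ≗ ψ → Labels φ f → Labels ψ f
  labels-resp φ≗ψ φf v = trans (cong (count (_≟ v)) (sym (tabulate-cong φ≗ψ))) (φf v)

  labels? : ∀ {k} (φ : Fin k → V) (f : Config order k) → Dec (Labels φ f)
  labels? φ f = all-vertices? λ v → fibreSize φ v ℕₚ.≟ pebblesAt f v

  reachable? : ∀ {k} (f g : Config order k) → Dec (Reachable f g)
  reachable? f g =
    any-map? (λ {φ} {ψ} φ≗ψ (γ , φf , γg , step) →
                γ , labels-resp {f = f} φ≗ψ φf , γg ,
                λ i → subst (λ u → u ≡ γ i ⊎ u ~ γ i) (φ≗ψ i) (step i))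
      λ φ → any-map? (λ γ≗δ (φf , γg , step) →
                        φf , labels-resp {f = g} γ≗δ γg ,
                        λ i → subst (λ u → φ i ≡ u ⊎ φ i ~ u) (γ≗δ i) (step i))
        λ γ → labels? φ f ×-dec labels? γ g
                ×-dec all? (λ i → (φ i ≟ γ i) ⊎-dec (φ i ~? γ i))

infix 8 _[_]

_[_] : Graph → ℕ → Graph
G [ k ] = record
  { V           = Config order k
  ; order       = numConfigs order k
  ; enumeration = Config-enumeration order k
  ; _~_         = λ f g → f ≢ g × Reachable G f g
  ; ~-sym       = λ {f} {g} (f≢g , r) → f≢g ∘ sym , reachable-sym G f g r
  ; ~-irrefl    = λ (f≢f , _) → f≢f refl
  ; _~?_        = λ f g → ¬? (inj⇒≟ (↔⇒↣ (Config-enumeration order k)) f g)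
                            ×-dec reachable? G f g
  }
  where open Graph G

{-# OPTIONS --safe #-}
module Submission where

-- By Hall's theorem, configurations f and g are adjacent or equal iff
-- f(S) + g(T) ≤ k for all S, T with no edge or common vertex between them. Call
-- such pairs compatible; it suffices to cover the configurations supported in U
-- by O(k^(α(U) − 1)) classes of pairwise compatible ones, by induction on |U|.
-- A configuration vanishing at a vertex w is supported in U ∖ w. If U splits into
-- parts A and B without edges in between, fix f(A) and cover both parts. If U is a
-- clique, one class suffices. Otherwise α(U) ≥ 2 and U is connected: let the
-- minimum of f on U be f(w), between M and 2M for a power M of 2, and round f − M
-- down to multiples of δ, about M / n. This leaves O(k / M) units on U ∖ w, hence
-- O((k / M)^(α(U) − 1)) classes for each M, and the sum over M is geometric.
-- Rounding is harmless as connectedness leaves some vertex of U outside S ∪ T, and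
-- its M pebbles exceed the total rounding error.

open import Algebra.Properties.CommutativeSemigroup using (interchange; xy∙z≈xz∙y)
open import Algebra.Properties.Semiring.Sum using ()
open import Data.Bool using (Bool; true; false; _∧_; _∨_; not; if_then_else_)
open import Data.Bool.Properties using (∧-zeroʳ)
open import Data.Empty using (⊥-elim)
open import Data.Fin using (Fin; zero; suc)
import Data.Fin as Fin
import Data.Fin.Properties as Finₚ
open import Data.Fin.Subset using (Subset; ∣_∣; _∈_)
open import Data.Fin.Subset.Properties using (anySubset?; ∣p∣≤n)
open import Data.List using (List; []; _∷_; allFin)
open import Data.List.Membership.Propositional.Properties using (∈-allFin)
open import Data.List.Relation.Unary.All as All using (All; []; _∷_)
open import Data.Nat
open import Data.Nat.DivMod using (m%n<n; m/n*n≤m; m≡m%n+[m/n]*n; 0/n≡0; m*n/n≡m; /-monoˡ-≤; m<n*o⇒m/o<n)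
open import Data.Nat.Properties
open import Data.Nat.Tactic.RingSolver using (solve-∀)
open import Data.Product using (Σ-syntax; ∃; ∃-syntax; _×_; _,_; proj₁; proj₂)
open import Data.Sum using (_⊎_; inj₁; inj₂)
open import Data.Vec as Vec using (Vec; []; _∷_; lookup; tabulate; here; there)
open import Data.Vec.Properties using (lookup∘tabulate; []=⇒lookup)
open import Function using (_∘_; const; Inverse)
open import Relation.Binary.PropositionalEquality hiding ([_])
open import Relation.Nullary using (¬_; Dec; yes; no; does; contradiction)
open import Relation.Nullary.Decidable using (map′; _×-dec_; _⊎-dec_; _→-dec_; ¬?; dec-true)
open import Defs using (Graph; α; _[_]; α-upper; α-attained; Config; fibreSize; Reachable)
import Defs

open Algebra.Properties.Semiring.Sum +-*-semiring using (sum; sum-cong-≗; ∑-distrib-+; *-distribˡ-sum)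

private variable
  n : ℕ

-- Sums and weights over finite sets

^-distribʳ-* : ∀ m n o → (n * o) ^ m ≡ n ^ m * o ^ m
^-distribʳ-* zero    n o = refl
^-distribʳ-* (suc m) n o = trans (cong (n * o *_) (^-distribʳ-* m n o))
                                 (interchange *-commutativeSemigroup n o (n ^ m) (o ^ m))

sum-mono-≤ : {f g : Fin n → ℕ} → (∀ i → f i ≤ g i) → sum f ≤ sum g
sum-mono-≤ {zero}  f≤g = z≤n
sum-mono-≤ {suc n} f≤g = +-mono-≤ (f≤g zero) (sum-mono-≤ (f≤g ∘ suc))

sum-zero : {f : Fin n → ℕ} → (∀ i → f i ≡ 0) → sum f ≡ 0
sum-zero {zero}  f≡0 = refl
sum-zero {suc n} f≡0 = cong₂ _+_ (f≡0 zero) (sum-zero (f≡0 ∘ suc))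

term≤sum : (f : Fin n → ℕ) → ∀ i → f i ≤ sum f
term≤sum f zero    = m≤m+n _ _
term≤sum f (suc i) = ≤-trans (term≤sum (f ∘ suc) i) (m≤n+m _ _)

sum-positive : (f : Fin n → ℕ) → 1 ≤ sum f → ∃[ i ] 1 ≤ f i
sum-positive {suc n} f 1≤ with f zero in eq
... | suc m = zero , subst (1 ≤_) (sym eq) (s≤s z≤n)
... | zero  with sum-positive (f ∘ suc) 1≤
...   | i , 1≤fi = suc i , 1≤fi

infix 7 _⇂_

_⇂_ : (Fin n → ℕ) → (Fin n → Bool) → Fin n → ℕ
(f ⇂ S) i = if S i then f i else 0

weight : (Fin n → Bool) → (Fin n → ℕ) → ℕ
weight S f = sum (f ⇂ S)

⁅_⁆ : Fin n → Fin n → Bool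
⁅ u ⁆ i = does (u Fin.≟ i)

⁅⁆-refl : (u : Fin n) → ⁅ u ⁆ u ≡ true
⁅⁆-refl u = dec-true (u Fin.≟ u) refl

⁅⁆-true : (u i : Fin n) → ⁅ u ⁆ i ≡ true → u ≡ i
⁅⁆-true u i p with u Fin.≟ i
... | yes eq = eq

⇂-≤ : (f : Fin n → ℕ) (S : Fin n → Bool) → ∀ i → (f ⇂ S) i ≤ f i
⇂-≤ f S i with S i
... | true  = ≤-refl
... | false = z≤n

weight≤sum : ∀ S (f : Fin n → ℕ) → weight S f ≤ sum f
weight≤sum S f = sum-mono-≤ (⇂-≤ f S)

weight-congˡ : {S T : Fin n → Bool} (f : Fin n → ℕ) → S ≗ T → weight S f ≡ weight T f
weight-congˡ f S≗T = sum-cong-≗ λ i → cong (if_then f i else 0) (S≗T i)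

weight-+ : ∀ S (f g : Fin n → ℕ) → weight S (λ i → f i + g i) ≡ weight S f + weight S g
weight-+ S f g = trans (sum-cong-≗ step) (∑-distrib-+ (f ⇂ S) (g ⇂ S))
  where
  step : ∀ i → ((λ i → f i + g i) ⇂ S) i ≡ (f ⇂ S) i + (g ⇂ S) i
  step i with S i
  ... | true  = refl
  ... | false = refl

weight-⁅⁆ : (u : Fin n) (f : Fin n → ℕ) → weight ⁅ u ⁆ f ≡ f u
weight-⁅⁆ zero    f = trans (cong (f zero +_) (sum-zero {f = f ∘ suc ⇂ const false} λ _ → refl))
                            (+-identityʳ _)
weight-⁅⁆ (suc u) f = weight-⁅⁆ u (f ∘ suc)

weight-∪-∩ : ∀ S T (f : Fin n → ℕ) →
             weight (λ i → S i ∨ T i) f + weight (λ i → S i ∧ T i) f ≡ weight S f + weight T f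
weight-∪-∩ S T f = begin
  weight (λ i → S i ∨ T i) f + weight (λ i → S i ∧ T i) f
    ≡⟨ ∑-distrib-+ (f ⇂ λ i → S i ∨ T i) (f ⇂ λ i → S i ∧ T i) ⟨
  sum (λ i → (f ⇂ λ i → S i ∨ T i) i + (f ⇂ λ i → S i ∧ T i) i)
    ≡⟨ sum-cong-≗ step ⟩
  sum (λ i → (f ⇂ S) i + (f ⇂ T) i)
    ≡⟨ ∑-distrib-+ (f ⇂ S) (f ⇂ T) ⟩
  weight S f + weight T f ∎
  where
  open ≡-Reasoning
  step : ∀ i → (f ⇂ λ i → S i ∨ T i) i + (f ⇂ λ i → S i ∧ T i) i ≡ (f ⇂ S) i + (f ⇂ T) i
  step i with S i | T i
  ... | true  | true  = refl
  ... | true  | false = refl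
  ... | false | true  = +-identityʳ _
  ... | false | false = refl

∧-true : ∀ {a b} → a ∧ b ≡ true → a ≡ true × b ≡ true
∧-true {true} {true} _ = refl , refl

∨-true : ∀ {a b} → a ∨ b ≡ true → a ≡ true ⊎ b ≡ true
∨-true {true}  _ = inj₁ refl
∨-true {false} p = inj₂ p

-- Placing and removing single pebbles

occurrences : ∀ {k} → (Fin k → Fin n) → Fin n → ℕ
occurrences φ v = sum λ i → if ⁅ φ i ⁆ v then 1 else 0

_◂_ : ∀ {k} → Fin n → (Fin k → Fin n) → Fin (suc k) → Fin n
(u ◂ φ) zero    = u
(u ◂ φ) (suc i) = φ i

remove : Fin n → (Fin n → ℕ) → Fin n → ℕ
remove u f i = if ⁅ u ⁆ i then pred (f i) else f i

remove-+ : ∀ {u} {f : Fin n → ℕ} → 1 ≤ f u → ∀ i → f i ≡ (if ⁅ u ⁆ i then 1 else 0) + remove u f i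
remove-+ {u = u} {f} 1≤fu i with u Fin.≟ i
... | no _     = refl
... | yes refl with f u | 1≤fu
...   | suc _ | _ = refl

weight-remove : ∀ {u} {f : Fin n → ℕ} → 1 ≤ f u → ∀ S →
                weight S f ≡ (if S u then 1 else 0) + weight S (remove u f)
weight-remove {u = u} {f} 1≤fu S = begin
  weight S f
    ≡⟨ sum-cong-≗ (λ i → cong (λ m → if S i then m else 0) (remove-+ {f = f} 1≤fu i)) ⟩
  weight S (λ i → (if ⁅ u ⁆ i then 1 else 0) + remove u f i)
    ≡⟨ weight-+ S _ (remove u f) ⟩
  weight S (λ i → if ⁅ u ⁆ i then 1 else 0) + weight S (remove u f)
    ≡⟨ cong (_+ weight S (remove u f)) (trans (sum-cong-≗ swap) (weight-⁅⁆ u (const 1 ⇂ S))) ⟩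
  (if S u then 1 else 0) + weight S (remove u f) ∎
  where
  open ≡-Reasoning
  swap : ∀ i → (if S i then (if ⁅ u ⁆ i then 1 else 0) else 0) ≡ (if ⁅ u ⁆ i then (if S i then 1 else 0) else 0)
  swap i with S i | ⁅ u ⁆ i
  ... | true  | true  = refl
  ... | true  | false = refl
  ... | false | true  = refl
  ... | false | false = refl

sum-remove : ∀ {k} {u} {f : Fin n → ℕ} → 1 ≤ f u → sum f ≡ suc k → sum (remove u f) ≡ k
sum-remove {f = f} 1≤fu eq = suc-injective (trans (sym (weight-remove {f = f} 1≤fu (const true))) eq)

-- Sets of vertices and supports

_⊆_ : (S T : Fin n → Bool) → Set
S ⊆ T = ∀ i → S i ≡ true → T i ≡ true

_∖_ : (S T : Fin n → Bool) → Fin n → Bool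
(S ∖ T) i = S i ∧ not (T i)

size : (Fin n → Bool) → ℕ
size S = weight S (const 1)

size-≤ : (S : Fin n → Bool) → size S ≤ n
size-≤ {zero}  S = z≤n
size-≤ {suc n} S with S zero
... | true  = s≤s (size-≤ (S ∘ suc))
... | false = m≤n⇒m≤1+n (size-≤ (S ∘ suc))

nonempty⇒size : (S : Fin n → Bool) → ∀ {i} → S i ≡ true → 1 ≤ size S
nonempty⇒size S {i} i∈S =
  subst (_≤ size S) (cong (if_then 1 else 0) i∈S) (term≤sum (const 1 ⇂ S) i)

weight-const : ∀ (S : Fin n → Bool) c → weight S (const c) ≡ size S * c
weight-const S c = trans (sum-cong-≗ step) (trans (sym (*-distribˡ-sum c (const 1 ⇂ S))) (*-comm c _))
  where
  step : ∀ i → (const c ⇂ S) i ≡ c * (const 1 ⇂ S) i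
  step i with S i
  ... | true  = sym (*-identityʳ c)
  ... | false = sym (*-zeroʳ c)

weight-split : {A U : Fin n → Bool} → A ⊆ U → ∀ f → weight U f ≡ weight A f + weight (U ∖ A) f
weight-split {A = A} {U} A⊆U f =
  trans (sum-cong-≗ step) (∑-distrib-+ (f ⇂ A) (f ⇂ (U ∖ A)))
  where
  step : ∀ i → (f ⇂ U) i ≡ (f ⇂ A) i + (f ⇂ (U ∖ A)) i
  step i with A i in a | U i in u
  ... | true  | true  = sym (+-identityʳ _)
  ... | true  | false with () ← trans (sym u) (A⊆U i a)
  ... | false | true  = refl
  ... | false | false = refl

⁅⁆⊆ : {U : Fin n → Bool} → ∀ {w} → U w ≡ true → ⁅ w ⁆ ⊆ U
⁅⁆⊆ {w = w} w∈U i p with ⁅⁆-true w i p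
... | refl = w∈U

-- The search runs over vectors, so without function extensionality the predicate has to respect
-- pointwise equality.
subset? : {P : (Fin n → Bool) → Set} → (∀ {S T} → S ≗ T → P S → P T) →
          (∀ S → Dec (P S)) → Dec (∃ P)
subset? respects P? = map′ (λ (S , p) → lookup S , p)
                       (λ (S , p) → tabulate S , respects (sym ∘ lookup∘tabulate S) p)
                       (anySubset? (P? ∘ lookup))

record Supported (U : Fin n → Bool) (k : ℕ) (f : Fin n → ℕ) : Set where
  constructor supported
  field
    outside : ∀ {i} → U i ≡ false → f i ≡ 0
    total   : sum f ≡ k

open Supported

⇂-supported : ∀ (A : Fin n → Bool) f → Supported A (weight A f) (f ⇂ A)
⇂-supported A f = supported (λ {i} i∉A → cong (if_then f i else 0) i∉A) refl

supported-weight : ∀ {U : Fin n → Bool} {k f} → Supported U k f → weight U f ≡ k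
supported-weight {U = U} {f = f} sup = trans (sum-cong-≗ step) (total sup)
  where
  step : ∀ i → (f ⇂ U) i ≡ f i
  step i with U i in u
  ... | true  = refl
  ... | false = sym (outside sup u)

-- Covers by classes of pairwise related elements

-- A colouring of `D` with `N` keys in which equal keys force `_≈_`. The relation need not be
-- transitive, and the key may depend on the proof of membership, so overlapping pieces can be
-- combined freely.
record Cover {X : Set} (_≈_ : X → X → Set) (D : X → Set) (N : ℕ) : Set where
  field
    key   : ∀ {x} → D x → Fin N
    key-≈ : ∀ {x y} (p : D x) (q : D y) → key p ≡ key q → x ≈ y

open Cover

module _ {X : Set} {_≈_ : X → X → Set} where

  cover-clique : ∀ {D} → (∀ {x y} → D x → D y → x ≈ y) → Cover _≈_ D 1
  cover-clique clique = record { key = λ _ → zero ; key-≈ = λ p q _ → clique p q }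

  cover-empty : ∀ {D N} → (∀ {x} → ¬ D x) → Cover _≈_ D N
  cover-empty empty = record { key = λ p → ⊥-elim (empty p) ; key-≈ = λ p _ _ → ⊥-elim (empty p) }

  cover-≤ : ∀ {D M N} → M ≤ N → Cover _≈_ D M → Cover _≈_ D N
  cover-≤ M≤N c = record
    { key   = λ p → Fin.inject≤ (key c p) M≤N
    ; key-≈ = λ p q eq → key-≈ c p q (Finₚ.inject≤-injective M≤N M≤N _ _ eq)
    }

  cover-⊎ : ∀ {D E M N} → Cover _≈_ D M → Cover _≈_ E N → Cover _≈_ (λ x → D x ⊎ E x) (M + N)
  cover-⊎ {D} {E} {M} {N} c d = record { key = κ ; key-≈ = κ-≈ }
    where
    κ : ∀ {x} → D x ⊎ E x → Fin (M + N)
    κ (inj₁ p) = key c p Fin.↑ˡ N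
    κ (inj₂ p) = M Fin.↑ʳ key d p
    κ-≈ : ∀ {x y} (p : D x ⊎ E x) (q : D y ⊎ E y) → κ p ≡ κ q → x ≈ y
    κ-≈ (inj₁ p) (inj₁ q) eq = key-≈ c p q (Finₚ.↑ˡ-injective N _ _ eq)
    κ-≈ (inj₂ p) (inj₂ q) eq = key-≈ d p q (Finₚ.↑ʳ-injective M _ _ eq)
    κ-≈ (inj₁ p) (inj₂ q) eq
      with () ← trans (sym (Finₚ.splitAt-↑ˡ M _ N)) (trans (cong (Fin.splitAt M) eq) (Finₚ.splitAt-↑ʳ M N _))
    κ-≈ (inj₂ p) (inj₁ q) eq
      with () ← trans (sym (Finₚ.splitAt-↑ʳ M N _)) (trans (cong (Fin.splitAt M) eq) (Finₚ.splitAt-↑ˡ M _ N))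

  cover-∃ : ∀ {m} {D : Fin m → X → Set} {N} → (∀ i → Cover _≈_ (D i) N) → Cover _≈_ (λ x → Σ[ i ∈ Fin m ] D i x) (m * N)
  cover-∃ {m} {D} {N} c = record { key = λ (i , p) → Fin.combine i (key (c i) p) ; key-≈ = κ-≈ }
    where
    κ-≈ : ∀ {x y} (p : Σ[ i ∈ Fin m ] D i x) (q : Σ[ i ∈ Fin m ] D i y) →
          Fin.combine (proj₁ p) (key (c (proj₁ p)) (proj₂ p)) ≡ Fin.combine (proj₁ q) (key (c (proj₁ q)) (proj₂ q)) →
          x ≈ y
    κ-≈ (i , p) (j , q) eq with Finₚ.combine-injective i _ j _ eq
    ... | refl , eq′ = key-≈ (c i) p q eq′

  cover-⊆ : ∀ {D E N} → (∀ {x} → D x → E x) → Cover _≈_ E N → Cover _≈_ D N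
  cover-⊆ D⊆E c = record { key = λ p → key c (D⊆E p) ; key-≈ = λ p q → key-≈ c (D⊆E p) (D⊆E q) }

  cover-pullback : ∀ {Y : Set} {_≈′_ : Y → Y → Set} {D E N} (h : X → Y) →
                   (∀ {x} → D x → E (h x)) → (∀ {x y} → D x → D y → h x ≈′ h y → x ≈ y) →
                   Cover _≈′_ E N → Cover _≈_ D N
  cover-pullback h D⇒E reflect c = record
    { key   = λ p → key c (D⇒E p)
    ; key-≈ = λ p q eq → reflect p q (key-≈ c (D⇒E p) (D⇒E q) eq)
    }

  cover-× : ∀ {Y Z : Set} {_≈₁_ : Y → Y → Set} {_≈₂_ : Z → Z → Set} {D E F M N} (h : X → Y) (h′ : X → Z) →
            (∀ {x} → D x → E (h x)) → (∀ {x} → D x → F (h′ x)) →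
            (∀ {x y} → D x → D y → h x ≈₁ h y → h′ x ≈₂ h′ y → x ≈ y) →
            Cover _≈₁_ E M → Cover _≈₂_ F N → Cover _≈_ D (M * N)
  cover-× {D = D} {M = M} {N} h h′ D⇒E D⇒F reflect c d = record { key = κ ; key-≈ = κ-≈ }
    where
    κ : ∀ {x} → D x → Fin (M * N)
    κ p = Fin.combine (key c (D⇒E p)) (key d (D⇒F p))
    κ-≈ : ∀ {x y} (p : D x) (q : D y) → κ p ≡ κ q → x ≈ y
    κ-≈ p q eq with Finₚ.combine-injective (key c (D⇒E p)) _ (key c (D⇒E q)) _ eq
    ... | eq₁ , eq₂ = reflect p q (key-≈ c _ _ eq₁) (key-≈ d _ _ eq₂)

  -- The classes L M, for M = 1, 2, 4, …, contribute at most Y / M each.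
  cover-dyadic : ∀ {E L : ℕ → X → Set} {k Y} →
                 (∀ {M x} → k < M → ¬ E M x) →
                 (∀ {M x} → E M x → L M x ⊎ E (M + M) x) →
                 (∀ {M} → 1 ≤ M → M ≤ k → ∃[ N ] Cover _≈_ (L M) N × N * M ≤ Y) →
                 Cover _≈_ (E 1) (Y + Y)
  cover-dyadic {E} {L} {k} {Y} empty step level with go (suc k) 1 (s≤s z≤n) (m≤n⇒m≤1+n ≤-refl)
    where
    -- `t` is fuel: doubling `M` raises it by at least one. The invariant scales the count by `M`,
    -- which lets the bound `Y + Y` reproduce itself from one scale to the next.
    go : ∀ t M → 1 ≤ M → k < M + t → ∃[ N ] Cover _≈_ (E M) N × N * M ≤ Y + Y
    go t M 1≤M k<M+t with k <? M
    ... | yes k<M = 0 , cover-empty (empty k<M) , z≤n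
    go zero    M 1≤M k<M+t | no k≮M = contradiction (subst (k <_) (+-identityʳ M) k<M+t) k≮M
    go (suc t) M 1≤M k<M+t | no k≮M with level 1≤M (≮⇒≥ k≮M) | go t (M + M) (≤-trans 1≤M (m≤m+n M M)) k<
      where
      k< : k < M + M + t
      k< = begin-strict
        k           <⟨ k<M+t ⟩
        M + suc t   ≡⟨ +-suc M t ⟩
        suc M + t   ≤⟨ +-monoˡ-≤ t (+-monoˡ-≤ M 1≤M) ⟩
        M + M + t   ∎
        where open ≤-Reasoning
    ... | N₁ , c₁ , p₁ | N₂ , c₂ , p₂ =
      N₁ + N₂ , cover-⊆ step (cover-⊎ c₁ c₂) ,
      (begin
        (N₁ + N₂) * M     ≡⟨ *-distribʳ-+ M N₁ N₂ ⟩
        N₁ * M + N₂ * M   ≤⟨ +-mono-≤ p₁ half ⟩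
        Y + Y             ∎)
      where
      open ≤-Reasoning
      -- The tail satisfies the invariant at `M + M`, so measured at `M` it costs only half of
      -- `Y + Y`, leaving the other `Y` for the current level.
      half : N₂ * M ≤ Y
      half = ≮⇒≥ λ Y< → <⇒≱ (+-mono-< Y< Y<) (subst (_≤ Y + Y) (*-distribˡ-+ N₂ M M) p₂)
  ... | N , c , p = cover-≤ (subst (_≤ Y + Y) (*-identityʳ N) p) c

-- Hall's theorem for pebbles

module Confusability {n} (R : Fin n → Fin n → Set) (R? : ∀ i j → Dec (R i j))
                     (R-refl : ∀ {i} → R i i) (R-sym : ∀ {i j} → R i j → R j i) where

  Anticomplete : (S T : Fin n → Bool) → Set
  Anticomplete S T = ∀ {i j} → S i ≡ true → T j ≡ true → ¬ R i j

  anticomplete? : ∀ S T → Dec (Anticomplete S T)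
  anticomplete? S T = map′ (λ h {i} {j} → h i j) (λ h i j → h)
    (Finₚ.all? λ i → Finₚ.all? λ j →
      (S i Data.Bool.≟ true) →-dec ((T j Data.Bool.≟ true) →-dec ¬? (R? i j)))

  anticomplete-cong : ∀ {S S′ T T′} → S ≗ S′ → T ≗ T′ → Anticomplete S T → Anticomplete S′ T′
  anticomplete-cong S≗ T≗ anti {i} {j} p q = anti (trans (S≗ i) p) (trans (T≗ j) q)

  -- Hall's condition for moving f to g, made symmetric: the pebbles of f on S
  -- must find room outside every T that no vertex of S can reach.
  Compatible : ℕ → (Fin n → ℕ) → (Fin n → ℕ) → Set
  Compatible k f g = ∀ S T → Anticomplete S T → weight S f + weight T g ≤ k

  Violation : ℕ → (Fin n → ℕ) → (Fin n → ℕ) → Set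
  Violation k f g = ∃[ S ] ∃[ T ] Anticomplete S T × k < weight S f + weight T g

  compatible-or-violation : ∀ k f g → Compatible k f g ⊎ Violation k f g
  compatible-or-violation k f g
    with anySubset? (λ S → anySubset? (λ T →
           anticomplete? (lookup S) (lookup T) ×-dec (k <? weight (lookup S) f + weight (lookup T) g)))
  ... | yes (S , T , v) = inj₂ (lookup S , lookup T , v)
  ... | no ¬v = inj₁ λ S T anti → ≮⇒≥ λ k< → ¬v
    ( tabulate S , tabulate T
    , anticomplete-cong (sym ∘ lookup∘tabulate S) (sym ∘ lookup∘tabulate T) anti
    , subst (k <_) (sym (cong₂ _+_ (weight-congˡ f (lookup∘tabulate S))
                                   (weight-congˡ g (lookup∘tabulate T)))) k<)

  Tight : ℕ → (Fin n → ℕ) → (Fin n → ℕ) → (S T : Fin n → Bool) → Set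
  Tight k f g S T = Anticomplete S T × weight S f + weight T g ≡ k

  -- Uncrossing: by modularity of weights, the two tight pairs together weigh as much as the pairs
  -- (union, intersection) and (intersection, union). Both of these are anticomplete, so each weighs
  -- at most `k`, and the total `k + k` forces equality.
  tight-uncross : ∀ {k f g S T S′ T′} → Compatible k f g → Tight k f g S T → Tight k f g S′ T′ →
                  Tight k f g (λ i → S i ∨ S′ i) (λ i → T i ∧ T′ i)
  tight-uncross {k} {f} {g} {S} {T} {S′} {T′} compat (anti , eq) (anti′ , eq′) =
    anti∪∩ , ≤-antisym ∪∩≤ (+-cancelʳ-≤ k k _ (begin
      k + k                                 ≡⟨ cong₂ _+_ eq eq′ ⟨
      (weight S f + weight T g) + (weight S′ f + weight T′ g)
        ≡⟨ interchange +-commutativeSemigroup (weight S f) (weight T g) (weight S′ f) (weight T′ g) ⟩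
      (weight S f + weight S′ f) + (weight T g + weight T′ g)
        ≡⟨ cong₂ _+_ (weight-∪-∩ S S′ f) (weight-∪-∩ T T′ g) ⟨
      (weight S∪ f + weight S∩ f) + (weight T∪ g + weight T∩ g)
        ≡⟨ regroup (weight S∪ f) (weight S∩ f) (weight T∪ g) (weight T∩ g) ⟩
      (weight S∪ f + weight T∩ g) + (weight S∩ f + weight T∪ g)
        ≤⟨ +-monoʳ-≤ _ (compat S∩ T∪ anti∩∪) ⟩
      (weight S∪ f + weight T∩ g) + k       ∎))
    where
    open ≤-Reasoning
    S∪ S∩ T∪ T∩ : Fin n → Bool
    S∪ i = S i ∨ S′ i
    S∩ i = S i ∧ S′ i
    T∪ i = T i ∨ T′ i
    T∩ i = T i ∧ T′ i
    regroup : ∀ a b c d → (a + b) + (c + d) ≡ (a + d) + (b + c)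
    regroup = solve-∀
    anti∪∩ : Anticomplete S∪ T∩
    anti∪∩ p q with ∨-true p | ∧-true q
    ... | inj₁ s | t , t′ = anti s t
    ... | inj₂ s | t , t′ = anti′ s t′
    anti∩∪ : Anticomplete S∩ T∪
    anti∩∪ p q with ∧-true p | ∨-true q
    ... | s , s′ | inj₁ t = anti s t
    ... | s , s′ | inj₂ t = anti′ s′ t
    ∪∩≤ : weight S∪ f + weight T∩ g ≤ k
    ∪∩≤ = compat S∪ T∩ anti∪∩

  module _ {k f g} (sum-g : sum g ≡ suc k) (compat : Compatible (suc k) f g)
           {u} (1≤fu : 1 ≤ f u) where

    -- A vertex to which one pebble of `u` can go so that the remaining pebbles still satisfy Hall's
    -- condition.
    Target : Fin n → Set
    Target v = R u v × 1 ≤ g v × Compatible k (remove u f) (remove v g)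

    Avoids : (Fin n → Bool) → Fin n → Set
    Avoids T v = R u v → 1 ≤ g v → T v ≡ false

    -- The weight of the violating pair exceeds `k` after the removal and is at most `suc k` before
    -- it. Hence it is exactly `suc k` before, and the removals cost nothing, which keeps `u` out of
    -- `S` and `v` out of `T`.
    violation⇒tight : ∀ {v} → 1 ≤ g v → Violation k (remove u f) (remove v g) →
                      ∃[ S ] ∃[ T ] Tight (suc k) f g S T × S u ≡ false × T v ≡ false
    violation⇒tight {v} 1≤gv (S , T , anti , k<) =
      S , T , (anti , ≤-antisym le ge)
        , unused (S u) split-f le (≤-trans k< (+-monoʳ-≤ _ g⁻≤))
        , unused (T v) split-g (subst (_≤ suc k) (+-comm (weight S f) _) le)
                 (subst (k <_) (+-comm (weight S f) _) (≤-trans k< (+-monoˡ-≤ _ f⁻≤)))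
      where
      split-f : weight S f ≡ (if S u then 1 else 0) + weight S (remove u f)
      split-f = weight-remove 1≤fu S
      split-g : weight T g ≡ (if T v then 1 else 0) + weight T (remove v g)
      split-g = weight-remove 1≤gv T
      f⁻≤ : weight S (remove u f) ≤ weight S f
      f⁻≤ = subst (weight S (remove u f) ≤_) (sym split-f) (m≤n+m _ _)
      g⁻≤ : weight T (remove v g) ≤ weight T g
      g⁻≤ = subst (weight T (remove v g) ≤_) (sym split-g) (m≤n+m _ _)
      le : weight S f + weight T g ≤ suc k
      le = compat S T anti
      ge : suc k ≤ weight S f + weight T g
      ge = ≤-trans k< (+-mono-≤ f⁻≤ g⁻≤)
      unused : ∀ b {a a⁻ c} → a ≡ (if b then 1 else 0) + a⁻ → a + c ≤ suc k → k < a⁻ + c → b ≡ false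
      unused false _    _  _  = refl
      unused true  refl le k< = contradiction (≤-trans (s≤s k<) le) (<-irrefl refl)

    -- As long as no target appears, the tight pairs blocking the candidates are merged by
    -- uncrossing: the union of the first sets still omits `u`, and the intersection of the second
    -- sets omits every candidate seen so far.
    targets : ∀ vs → ∃ Target ⊎
              (∃[ S ] ∃[ T ] Tight (suc k) f g S T × S u ≡ false × All (Avoids T) vs)
    -- The empty set paired with the set of all vertices is tight because `g` has `suc k` pebbles in
    -- total.
    targets [] = inj₂ (const false , const true , ((λ ()) , cong₂ _+_ (sum-zero {f = f ⇂ const false} λ _ → refl) sum-g)
                       , refl , [])
    targets (v ∷ vs) with targets vs
    ... | inj₁ target = inj₁ target
    ... | inj₂ (S , T , tight , u∉S , avoids) with R? u v | 1 ≤? g v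
    ...   | no ¬uRv | _        = inj₂ (S , T , tight , u∉S , (λ uRv → contradiction uRv ¬uRv) ∷ avoids)
    ...   | yes _   | no 1≰gv  = inj₂ (S , T , tight , u∉S , (λ _ 1≤gv → contradiction 1≤gv 1≰gv) ∷ avoids)
    ...   | yes uRv | yes 1≤gv with compatible-or-violation k (remove u f) (remove v g)
    ...     | inj₁ compat⁻ = inj₁ (v , uRv , 1≤gv , compat⁻)
    ...     | inj₂ violation with violation⇒tight 1≤gv violation
    ...       | S′ , T′ , tight′ , u∉S′ , v∉T′ =
      inj₂ ( _ , _ , tight-uncross compat tight tight′ , cong₂ _∨_ u∉S u∉S′
           , (λ _ _ → trans (cong (T v ∧_) v∉T′) (∧-zeroʳ (T v)))
           ∷ All.map (λ avoid uRv 1≤g → cong (_∧ _) (avoid uRv 1≤g)) avoids)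

    -- If every target of u were blocked, the union of the blocking tight pairs
    -- could be enlarged by u at no cost, since it avoids all of u's targets.
    target : ∃ Target
    target with targets (allFin n)
    ... | inj₁ t = t
    ... | inj₂ (S , T , (anti , eq) , u∉S , avoids) =
      contradiction (compat S⁺ T⁻ anti⁺) (<⇒≱ (begin-strict
        suc k                                   ≡⟨ eq ⟨
        weight S f + weight T g                 <⟨ m<n+m _ {f u} 1≤fu ⟩
        f u + (weight S f + weight T g)         ≡⟨ +-assoc (f u) _ _ ⟨
        (f u + weight S f) + weight T g         ≡⟨ cong₂ _+_ grow shrink ⟩
        weight S⁺ f + weight T⁻ g               ∎))
      where
      open ≤-Reasoning
      S⁺ T⁻ : Fin n → Bool
      S⁺ i = ⁅ u ⁆ i ∨ S i
      T⁻ i = T i ∧ not (does (R? u i))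
      anti⁺ : Anticomplete S⁺ T⁻
      anti⁺ {i} {j} p q with ∨-true p | ∧-true q
      ... | inj₂ s | t , _ = anti s t
      ... | inj₁ u≡i | t , ¬Ruj with ⁅⁆-true u i u≡i | R? u j
      ...   | refl | no ¬uRj = ¬uRj
      ...   | refl | yes _ with () ← ¬Ruj
      disjoint : ∀ i → (⁅ u ⁆ i ∧ S i) ≡ false
      disjoint i with u Fin.≟ i
      ... | yes refl = u∉S
      ... | no _ = refl
      grow : f u + weight S f ≡ weight S⁺ f
      grow = begin-equality
        f u + weight S f           ≡⟨ cong (_+ weight S f) (weight-⁅⁆ u f) ⟨
        weight ⁅ u ⁆ f + weight S f ≡⟨ weight-∪-∩ ⁅ u ⁆ S f ⟨
        weight S⁺ f + weight (λ i → ⁅ u ⁆ i ∧ S i) f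
          ≡⟨ cong (weight S⁺ f +_) (trans (weight-congˡ f disjoint) (sum-zero {f = f ⇂ const false} λ _ → refl)) ⟩
        weight S⁺ f + 0            ≡⟨ +-identityʳ _ ⟩
        weight S⁺ f                ∎
      pointwise : ∀ i → (g ⇂ T) i ≡ (g ⇂ T⁻) i
      pointwise i with T i in t | R? u i
      ... | false | _       = refl
      ... | true  | no _    = refl
      ... | true  | yes uRi with g i in gi
      ...   | zero  = refl
      ...   | suc m with () ← trans (sym t) (All.lookup avoids (∈-allFin i) uRi (subst (1 ≤_) (sym gi) (s≤s z≤n)))
      shrink : weight T g ≡ weight T⁻ g
      shrink = sum-cong-≗ pointwise

  -- Induction on the number of pebbles: a pebble of `f` at `u` is matched with a pebble of `g` at a
  -- target `v`, and the rest is matched recursively.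
  hall : ∀ k {f g} → sum f ≡ k → sum g ≡ k → Compatible k f g →
         ∃[ φ ] ∃[ γ ] occurrences {k = k} φ ≗ f × occurrences {k = k} γ ≗ g × (∀ i → R (φ i) (γ i))
  hall zero {f} {g} sum-f sum-g _ =
    (λ ()) , (λ ()) , vanish f sum-f , vanish g sum-g , λ ()
    where
    vanish : ∀ (f : Fin n → ℕ) → sum f ≡ 0 → ∀ i → 0 ≡ f i
    vanish f eq i = sym (n≤0⇒n≡0 (≤-trans (term≤sum f i) (≤-reflexive eq)))
  hall (suc k) {f} {g} sum-f sum-g compat
    with sum-positive f (subst (1 ≤_) (sym sum-f) (s≤s z≤n))
  ... | u , 1≤fu with target sum-g compat 1≤fu
  ...   | v , uRv , 1≤gv , compat⁻
    with hall k (sum-remove {f = f} 1≤fu sum-f) (sum-remove {f = g} 1≤gv sum-g) compat⁻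
  ...     | φ , γ , φf , γg , φRγ =
    u ◂ φ , v ◂ γ
    , (λ i → trans (cong ((if ⁅ u ⁆ i then 1 else 0) +_) (φf i)) (sym (remove-+ {f = f} 1≤fu i)))
    , (λ i → trans (cong ((if ⁅ v ⁆ i then 1 else 0) +_) (γg i)) (sym (remove-+ {f = g} 1≤gv i)))
    , λ { zero → uRv ; (suc i) → φRγ i }

  -- Independence and connectedness

  Independent : (Fin n → Bool) → Set
  Independent I = ∀ {i j} → I i ≡ true → I j ≡ true → R i j → i ≡ j

  independent? : ∀ I → Dec (Independent I)
  independent? I = map′ (λ h {i} {j} → h i j) (λ h i j → h)
    (Finₚ.all? λ i → Finₚ.all? λ j →
      (I i Data.Bool.≟ true) →-dec ((I j Data.Bool.≟ true) →-dec (R? i j →-dec (i Fin.≟ j))))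

  ⊆? : (S T : Fin n → Bool) → Dec (S ⊆ T)
  ⊆? S T = Finₚ.all? λ i → (S i Data.Bool.≟ true) →-dec (T i Data.Bool.≟ true)

  IndependentIn : (U I : Fin n → Bool) → Set
  IndependentIn U I = Independent I × I ⊆ U

  IndependenceBound : (Fin n → Bool) → ℕ → Set
  IndependenceBound U a = ∀ I → IndependentIn U I → size I ≤ a

  maximum-independent : ∀ U → ∃[ I ] IndependentIn U I × IndependenceBound U (size I)
  maximum-independent U = search n (λ I _ → size-≤ I)
    where
    respects : ∀ {m S T} → S ≗ T → IndependentIn U S × size S ≡ m → IndependentIn U T × size T ≡ m
    respects {S = S} {T} S≗T ((ind , S⊆U) , eq) =
      ( (λ {i} {j} p q → ind (trans (S≗T i) p) (trans (S≗T j) q))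
      , (λ i p → S⊆U i (trans (S≗T i) p)))
      , trans (sym (weight-congˡ (const 1) S≗T)) eq
    -- Descent from the trivial bound `n`: a bound that no independent set attains can be lowered by
    -- one.
    search : ∀ m → IndependenceBound U m → ∃[ I ] IndependentIn U I × IndependenceBound U (size I)
    search m bound with subset? (respects {m}) (λ I → (independent? I ×-dec ⊆? I U) ×-dec (size I ≟ m))
    search m       bound | yes (I , indI , refl) = I , indI , bound
    search zero    bound | no none =
      const false , ((λ ()) , λ _ ()) , λ I indI → ≤-trans (bound I indI) z≤n
    search (suc m) bound | no none =
      search m λ I indI → s≤s⁻¹ (≤∧≢⇒< (bound I indI) λ eq → none (I , indI , eq))

  ⁅⁆-independent : ∀ i → IndependentIn ⁅ i ⁆ ⁅ i ⁆
  ⁅⁆-independent i = (λ {j} {l} p q _ → trans (sym (⁅⁆-true i j p)) (⁅⁆-true i l q)) , λ _ p → p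

  independence-nonempty : ∀ {U a i} → U i ≡ true → IndependenceBound U a → 1 ≤ a
  independence-nonempty {i = i} i∈U bound =
    ≤-trans (nonempty⇒size ⁅ i ⁆ (⁅⁆-refl i)) (bound ⁅ i ⁆ (proj₁ (⁅⁆-independent i) , ⁅⁆⊆ i∈U))

  -- Reflexivity of `R` makes anticomplete sets disjoint, so sizes add. This superadditivity of the
  -- independence number controls the exponents when `U` splits.
  independent-∪ : ∀ {U A B I J} → A ⊆ U → B ⊆ U → Anticomplete A B → IndependentIn A I → IndependentIn B J →
                  IndependentIn U (λ i → I i ∨ J i) × size (λ i → I i ∨ J i) ≡ size I + size J
  independent-∪ {U} {A} {B} {I} {J} A⊆U B⊆U anti (indI , I⊆A) (indJ , J⊆B) = (ind , ⊆U) , count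
    where
    ind : Independent (λ i → I i ∨ J i)
    ind p q r with ∨-true p | ∨-true q
    ... | inj₁ i | inj₁ j = indI i j r
    ... | inj₂ i | inj₂ j = indJ i j r
    ... | inj₁ i | inj₂ j = contradiction r (anti (I⊆A _ i) (J⊆B _ j))
    ... | inj₂ i | inj₁ j = contradiction (R-sym r) (anti (I⊆A _ j) (J⊆B _ i))
    ⊆U : (λ i → I i ∨ J i) ⊆ U
    ⊆U x p with ∨-true p
    ... | inj₁ i = A⊆U x (I⊆A x i)
    ... | inj₂ j = B⊆U x (J⊆B x j)
    disjoint : ∀ i → (const 1 ⇂ λ i → I i ∧ J i) i ≡ 0
    disjoint i with I i in p | J i in q
    ... | true  | true  = contradiction R-refl (anti (I⊆A i p) (J⊆B i q))
    ... | true  | false = refl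
    ... | false | _     = refl
    count : size (λ i → I i ∨ J i) ≡ size I + size J
    count = begin
      size (λ i → I i ∨ J i)                             ≡⟨ +-identityʳ _ ⟨
      size (λ i → I i ∨ J i) + 0
        ≡⟨ cong (size (λ i → I i ∨ J i) +_) (sum-zero {f = const 1 ⇂ λ i → I i ∧ J i} disjoint) ⟨
      size (λ i → I i ∨ J i) + size (λ i → I i ∧ J i)    ≡⟨ weight-∪-∩ I J (const 1) ⟩
      size I + size J                                    ∎
      where open ≡-Reasoning

  independent-pair : ∀ {U a i j} → U i ≡ true → U j ≡ true → ¬ R i j → IndependenceBound U a → 2 ≤ a
  independent-pair {i = i} {j} i∈U j∈U ¬Rij bound
    with independent-∪ (⁅⁆⊆ i∈U) (⁅⁆⊆ j∈U) anti (⁅⁆-independent i) (⁅⁆-independent j)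
    where
    anti : Anticomplete ⁅ i ⁆ ⁅ j ⁆
    anti {x} {y} p q with ⁅⁆-true i x p | ⁅⁆-true j y q
    ... | refl | refl = ¬Rij
  ... | ind , count = ≤-trans
    (+-mono-≤ (nonempty⇒size ⁅ i ⁆ (⁅⁆-refl i)) (nonempty⇒size ⁅ j ⁆ (⁅⁆-refl j)))
    (subst (_≤ _) count (bound _ ind))

  record Split (U A : Fin n → Bool) : Set where
    constructor split
    field
      ⊆-whole      : A ⊆ U
      left         : ∃[ i ] A i ≡ true
      right        : ∃[ i ] (U ∖ A) i ≡ true
      anticomplete : Anticomplete A (U ∖ A)

  -- Connectedness phrased so as to produce the vertex whose pebbles pay for the rounding errors.
  Connected : (Fin n → Bool) → Set
  Connected U = ∀ S T → Anticomplete S T → ∀ {i j} → U i ≡ true → S i ≡ true → U j ≡ true → T j ≡ true →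
                ∃[ x ] U x ≡ true × S x ≡ false × T x ≡ false

  -- If an anticomplete pair `S`, `T` meeting `U` on both sides covered `U`, then the part of `U`
  -- outside `S` would lie in `T`, and `S` would cut `U` into two anticomplete parts.
  split-or-connected : ∀ U → ∃ (Split U) ⊎ Connected U
  split-or-connected U with subset? respects split?
    where
    split? : ∀ A → Dec (Split U A)
    split? A = map′ {A = A ⊆ U × (∃[ i ] A i ≡ true) × (∃[ i ] (U ∖ A) i ≡ true) × Anticomplete A (U ∖ A)}
      (λ (a , b , c , d) → split a b c d) (λ (split a b c d) → a , b , c , d)
      (⊆? A U ×-dec Finₚ.any? (λ i → A i Data.Bool.≟ true)
              ×-dec Finₚ.any? (λ i → (U ∖ A) i Data.Bool.≟ true)
              ×-dec anticomplete? A (U ∖ A))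
    respects : ∀ {A B} → A ≗ B → Split U A → Split U B
    respects A≗B (split a (i , b) (j , c) d) =
      split (λ i p → a i (trans (A≗B i) p)) (i , trans (sym (A≗B i)) b)
            (j , trans (cong (λ b → U j ∧ not b) (sym (A≗B j))) c)
            (anticomplete-cong A≗B (λ i → cong (λ b → U i ∧ not b) (A≗B i)) d)
  ... | yes s = inj₁ s
  ... | no ¬s = inj₂ connected
    where
    connected : Connected U
    connected S T anti {i} {j} i∈U i∈S j∈U j∈T
      with Finₚ.any? (λ x → (U x Data.Bool.≟ true) ×-dec (S x Data.Bool.≟ false) ×-dec (T x Data.Bool.≟ false))
    ... | yes found = found
    ... | no none = contradiction
      ((λ x → U x ∧ S x) , split (λ _ → proj₁ ∘ ∧-true) (i , cong₂ _∧_ i∈U i∈S) (j , j∈) anti′) ¬s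
      where
      j∉S : S j ≡ false
      j∉S with S j in s
      ... | true  = contradiction R-refl (anti s j∈T)
      ... | false = refl
      j∈ : (U ∖ (λ x → U x ∧ S x)) j ≡ true
      j∈ rewrite j∈U | j∉S = refl
      covered : ∀ {x} → (U ∖ (λ x → U x ∧ S x)) x ≡ true → T x ≡ true
      covered {x} p with U x in u | S x in s | T x in t
      ... | true | false | false = contradiction (x , u , s , t) none
      ... | true | false | true  = refl
      anti′ : Anticomplete (λ x → U x ∧ S x) (U ∖ (λ x → U x ∧ S x))
      anti′ p q = anti (proj₂ (∧-true {U _} p)) (covered q)

  -- Compatibility of configurations with a common support

  missed : {U S : Fin n → Bool} → ∀ {k f} → Supported U k f → ¬ (∃[ i ] U i ≡ true × S i ≡ true) → weight S f ≡ 0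
  missed {U} {S} {k} {f} sup none = sum-zero step
    where
    step : ∀ i → (f ⇂ S) i ≡ 0
    step i with S i in s | U i in u
    ... | false | _     = refl
    ... | true  | false = outside sup u
    ... | true  | true  = contradiction (i , u , s) none

  -- A set that misses `U` has weight 0, and the other weight is at most the total `k`; only pairs
  -- meeting `U` on both sides impose a condition.
  compatible-if-meeting : ∀ {U k f g} → Supported U k f → Supported U k g →
    (∀ S T → Anticomplete S T → ∀ {i j} → U i ≡ true → S i ≡ true → U j ≡ true → T j ≡ true →
      weight S f + weight T g ≤ k) →
    Compatible k f g
  compatible-if-meeting {U} {k} {f} {g} supf supg meeting S T anti
    with Finₚ.any? (λ i → (U i Data.Bool.≟ true) ×-dec (S i Data.Bool.≟ true))
       | Finₚ.any? (λ i → (U i Data.Bool.≟ true) ×-dec (T i Data.Bool.≟ true))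
  ... | yes (i , i∈U , i∈S) | yes (j , j∈U , j∈T) = meeting S T anti i∈U i∈S j∈U j∈T
  ... | no none | _ = subst (λ m → m + weight T g ≤ k) (sym (missed {S = S} supf none))
                            (≤-trans (weight≤sum T g) (≤-reflexive (total supg)))
  ... | yes _ | no none = subst (λ m → weight S f + m ≤ k) (sym (missed {S = T} supg none))
                                (≤-trans (≤-reflexive (+-identityʳ (weight S f)))
                                         (≤-trans (weight≤sum S f) (≤-reflexive (total supf))))

  -- Rounding

  record Dense (U : Fin n → Bool) (k M : ℕ) (f : Fin n → ℕ) : Set where
    constructor dense
    field
      support : Supported U k f
      large   : ∀ i → U i ≡ true → M ≤ f i

  open Dense

  module Rounding (M d : ℕ) where

    -- The rounding unit is `suc d`, so the error at a vertex is at most `d`.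
    level : (Fin n → ℕ) → Fin n → ℕ
    level f i = (f i ∸ M) / suc d

    -- The level at `w` is recorded separately. Dropping it here shrinks the support by a vertex, so
    -- that the induction on the size of `U` applies.
    residual : Fin n → (Fin n → ℕ) → Fin n → ℕ
    residual w f = level f ⇂ (const true ∖ ⁅ w ⁆)

    level-residual : ∀ w f i → level f i ≡ residual w f i + (const (level f w) ⇂ ⁅ w ⁆) i
    level-residual w f i with w Fin.≟ i
    ... | yes refl = refl
    ... | no _     = sym (+-identityʳ _)

    sum-level : ∀ w f → sum (level f) ≡ sum (residual w f) + level f w
    sum-level w f = begin
      sum (level f)                                                       ≡⟨ sum-cong-≗ (level-residual w f) ⟩
      sum (λ i → residual w f i + (const (level f w) ⇂ ⁅ w ⁆) i)           ≡⟨ ∑-distrib-+ (residual w f) _ ⟩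
      sum (residual w f) + weight ⁅ w ⁆ (const (level f w))               ≡⟨ cong (sum (residual w f) +_) (weight-⁅⁆ w _) ⟩
      sum (residual w f) + level f w                                      ∎
      where open ≡-Reasoning

    residual-supported : ∀ {U k w f} → Supported U k f → Supported (U ∖ ⁅ w ⁆) (sum (residual w f)) (residual w f)
    residual-supported {U} {k} {w} {f} sup = supported out refl
      where
      out : ∀ {i} → (U ∖ ⁅ w ⁆) i ≡ false → residual w f i ≡ 0
      out {i} i∉ with U i in u | ⁅ w ⁆ i
      ... | _     | true  = refl
      ... | false | false = trans (cong (_/ suc d) (trans (cong (_∸ M) (outside sup u)) (0∸n≡0 M))) (0/n≡0 (suc d))

    module _ {U k f} (D : Dense U k M f) where
      open ≤-Reasoning

      level-lower : ∀ i → (const M ⇂ U) i + suc d * level f i ≤ f i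
      level-lower i = begin
        (const M ⇂ U) i + suc d * level f i ≤⟨ +-monoʳ-≤ _ (≤-trans (≤-reflexive (*-comm (suc d) (level f i)))
                                                                    (m/n*n≤m (f i ∸ M) (suc d))) ⟩
        (const M ⇂ U) i + (f i ∸ M)         ≤⟨ below ⟩
        f i                                 ∎
        where
        below : (const M ⇂ U) i + (f i ∸ M) ≤ f i
        below with U i in u
        ... | true  = ≤-reflexive (m+[n∸m]≡n (large D i u))
        ... | false = m∸n≤m (f i) M

      level-upper : ∀ i → f i ≤ (const (M + d) ⇂ U) i + suc d * level f i
      level-upper i with U i in u
      ... | false = ≤-trans (≤-reflexive (outside (support D) u)) z≤n
      ... | true  = begin
        f i                                             ≡⟨ m+[n∸m]≡n (large D i u) ⟨
        M + (f i ∸ M)                                   ≡⟨ cong (M +_) (m≡m%n+[m/n]*n (f i ∸ M) (suc d)) ⟩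
        M + ((f i ∸ M) % suc d + level f i * suc d)     ≤⟨ +-monoʳ-≤ M (+-mono-≤ (s≤s⁻¹ (m%n<n (f i ∸ M) (suc d)))
                                                             (≤-reflexive (*-comm (level f i) (suc d)))) ⟩
        M + (d + suc d * level f i)                     ≡⟨ +-assoc M d _ ⟨
        M + d + suc d * level f i                       ∎

      module _ (w : Fin n) where

        total-level : ∀ c → sum (λ i → (const c ⇂ U) i + suc d * level f i)
                            ≡ size U * c + suc d * (sum (residual w f) + level f w)
        total-level c = begin-equality
          sum (λ i → (const c ⇂ U) i + suc d * level f i)          ≡⟨ ∑-distrib-+ (const c ⇂ U) _ ⟩
          weight U (const c) + sum (λ i → suc d * level f i)
            ≡⟨ cong₂ _+_ (weight-const U c) (sym (*-distribˡ-sum (suc d) (level f))) ⟩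
          size U * c + suc d * sum (level f)                       ≡⟨ cong (λ m → size U * c + suc d * m) (sum-level w f) ⟩
          size U * c + suc d * (sum (residual w f) + level f w)    ∎

        lower-total : size U * M + suc d * (sum (residual w f) + level f w) ≤ k
        lower-total = begin
          _      ≡⟨ total-level M ⟨
          _      ≤⟨ sum-mono-≤ level-lower ⟩
          sum f  ≡⟨ total (support D) ⟩
          k      ∎

        -- Together with `lower-total` this confines `sum (residual w f)` to an interval; once the
        -- level at `w` is bounded too, only boundedly many totals are left for the induction.
        upper-total : k ≤ size U * (M + d) + suc d * (sum (residual w f) + level f w)
        upper-total = begin
          k      ≡⟨ total (support D) ⟨
          sum f  ≤⟨ sum-mono-≤ level-upper ⟩
          _      ≡⟨ total-level (M + d) ⟩
          _      ∎

    -- Some vertex x of U lies outside S ∪ T, and the at least M pebbles on it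
    -- absorb the total rounding error.
    residual-reflects : ∀ {U k f g w K} → Connected U → size U * d ≤ M → Dense U k M f → Dense U k M g →
                        level f w ≡ level g w → sum (residual w f) ≡ K →
                        Compatible K (residual w f) (residual w g) → Compatible k f g
    residual-reflects {U} {k} {f} {g} {w} {K} conn error≤M Df Dg same sum-f compat =
      compatible-if-meeting (support Df) (support Dg) meeting
      where
      r = level f w
      meeting : ∀ S T → Anticomplete S T → ∀ {i j} → U i ≡ true → S i ≡ true → U j ≡ true → T j ≡ true →
                weight S f + weight T g ≤ k
      meeting S T anti i∈U i∈S j∈U j∈T with conn S T anti i∈U i∈S j∈U j∈T
      ... | x , x∈U , x∉S , x∉T = +-cancelʳ-≤ M _ k (begin
        weight S f + weight T g + M
          ≡⟨ cong (weight S f + weight T g +_) (weight-⁅⁆ x (const M)) ⟨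
        weight S f + weight T g + weight ⁅ x ⁆ (const M)
          ≡⟨ sum-+₃ (f ⇂ S) (g ⇂ T) (const M ⇂ ⁅ x ⁆) ⟨
        sum (λ i → (f ⇂ S) i + (g ⇂ T) i + (const M ⇂ ⁅ x ⁆) i)
          ≤⟨ sum-mono-≤ pointwise ⟩
        sum (λ i → (const (M + d) ⇂ U) i + suc d * (f″ i + g″ i + (const r ⇂ ⁅ w ⁆) i))
          ≡⟨ ∑-distrib-+ (const (M + d) ⇂ U) _ ⟩
        weight U (const (M + d)) + sum (λ i → suc d * (f″ i + g″ i + (const r ⇂ ⁅ w ⁆) i))
          ≡⟨ cong₂ _+_ (weight-const U (M + d)) (sym (*-distribˡ-sum (suc d) (λ i → f″ i + g″ i + (const r ⇂ ⁅ w ⁆) i))) ⟩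
        size U * (M + d) + suc d * sum (λ i → f″ i + g″ i + (const r ⇂ ⁅ w ⁆) i)
          ≡⟨ cong (λ m → size U * (M + d) + suc d * m)
                  (trans (sum-+₃ f″ g″ (const r ⇂ ⁅ w ⁆)) (cong (sum f″ + sum g″ +_) (weight-⁅⁆ w (const r)))) ⟩
        size U * (M + d) + suc d * (sum f″ + sum g″ + r)
          ≤⟨ +-mono-≤ (≤-reflexive (*-distribˡ-+ (size U) M d))
                      (*-monoʳ-≤ (suc d) (+-monoˡ-≤ r (≤-trans (compat S T anti) (≤-reflexive (sym sum-f))))) ⟩
        (size U * M + size U * d) + suc d * (sum (residual w f) + r)
          ≤⟨ +-monoˡ-≤ _ (+-monoʳ-≤ (size U * M) error≤M) ⟩
        (size U * M + M) + suc d * (sum (residual w f) + r)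
          ≡⟨ xy∙z≈xz∙y +-commutativeSemigroup (size U * M) M _ ⟩
        (size U * M + suc d * (sum (residual w f) + r)) + M
          ≤⟨ +-monoˡ-≤ M (lower-total Df w) ⟩
        k + M ∎)
        where
        open ≤-Reasoning
        f″ g″ : Fin n → ℕ
        f″ = residual w f ⇂ S
        g″ = residual w g ⇂ T
        sum-+₃ : ∀ (p q s : Fin n → ℕ) → sum (λ i → p i + q i + s i) ≡ sum p + sum q + sum s
        sum-+₃ p q s = trans (∑-distrib-+ (λ i → p i + q i) s) (cong (_+ sum s) (∑-distrib-+ p q))
        -- Since `f` and `g` have the same level `r` at `w`, a single term `r` at `w` serves for
        -- both.
        upper : ∀ {h} → Dense U k M h → level h w ≡ r → ∀ i →
                h i ≤ (const (M + d) ⇂ U) i + suc d * (residual w h i + (const r ⇂ ⁅ w ⁆) i)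
        upper {h} Dh eq i = subst (λ m → h i ≤ (const (M + d) ⇂ U) i + suc d * m)
          (trans (level-residual w h i) (cong (λ m → residual w h i + (const m ⇂ ⁅ w ⁆) i) eq)) (level-upper Dh i)
        -- `S` and `T` are disjoint by reflexivity of `R`, and `x` is in neither. So at most one of
        -- the three terms on the left is nonzero, and one copy of `M + d` at each vertex of `U`
        -- suffices.
        pointwise : ∀ i → (f ⇂ S) i + (g ⇂ T) i + (const M ⇂ ⁅ x ⁆) i
                          ≤ (const (M + d) ⇂ U) i + suc d * (f″ i + g″ i + (const r ⇂ ⁅ w ⁆) i)
        pointwise i with S i in s | T i in t | x Fin.≟ i
        ... | true  | true  | _        = contradiction R-refl (anti s t)
        ... | true  | false | yes refl with () ← trans (sym s) x∉S
        ... | false | true  | yes refl with () ← trans (sym t) x∉T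
        ... | true  | false | no _
          rewrite +-identityʳ (f i) | +-identityʳ (f i) | +-identityʳ (residual w f i) = upper Df refl i
        ... | false | true  | no _     rewrite +-identityʳ (g i) = upper Dg (sym same) i
        ... | false | false | no _     = z≤n
        ... | false | false | yes refl rewrite x∈U = ≤-trans (m≤m+n M d) (m≤m+n (M + d) _)

  -- No anticomplete pair meets a clique on both sides.
  clique-compatible : ∀ {U k f g} → (∀ i j → U i ≡ true → U j ≡ true → R i j) →
                      Supported U k f → Supported U k g → Compatible k f g
  clique-compatible clique supf supg = compatible-if-meeting supf supg
    λ S T anti i∈U i∈S j∈U j∈T → contradiction (clique _ _ i∈U j∈U) (anti i∈S j∈T)

  -- Covering the configurations supported in a set

  -- The exponent `b` stands for the independence number minus one. Bounding it by `n` keeps the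
  -- constant uniform, as powers of `2 + n` with exponent up to `b` arise from rounding; `suc k`
  -- instead of `k` accommodates `k = 0`.
  CoverBound : ℕ → ℕ → Set
  CoverBound s C = ∀ U → size U ≤ s → ∀ b → b ≤ n → IndependenceBound U (suc b) →
                   ∀ k → Cover (Compatible k) (Supported U k) (C * suc k ^ b)

  -- Fixing the number of pebbles on `A` costs a factor `suc k`. Additivity of independence numbers
  -- pays for it: if those of the parts are `suc b₁` and `suc b₂`, then `suc (b₁ + b₂) ≤ b`.
  cover-split : ∀ {s C} → CoverBound s C → ∀ {U} → size U ≤ suc s → ∀ b → b ≤ n → IndependenceBound U (suc b) →
                ∃ (Split U) → ∀ k → Cover (Compatible k) (Supported U k) (C * C * suc k ^ b)
  cover-split {s} {C} bound {U} U≤ b b≤n indep (A , split A⊆U (i , i∈A) (j , j∈B) anti) k =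
    cover-≤ count (cover-⊆ classify (cover-∃ cover-class))
    where
    B : Fin n → Bool
    B = U ∖ A
    B⊆U : B ⊆ U
    B⊆U _ = proj₁ ∘ ∧-true
    sizes : size U ≡ size A + size B
    sizes = weight-split A⊆U (const 1)
    A≤s : size A ≤ s
    A≤s = s≤s⁻¹ (begin
      suc (size A)      ≡⟨ +-comm 1 (size A) ⟩
      size A + 1        ≤⟨ +-monoʳ-≤ (size A) (nonempty⇒size B j∈B) ⟩
      size A + size B   ≡⟨ sizes ⟨
      size U            ≤⟨ U≤ ⟩
      suc s             ∎)
      where open ≤-Reasoning
    B≤s : size B ≤ s
    B≤s = s≤s⁻¹ (begin
      1 + size B        ≤⟨ +-monoˡ-≤ (size B) (nonempty⇒size A i∈A) ⟩
      size A + size B   ≡⟨ sizes ⟨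
      size U            ≤⟨ U≤ ⟩
      suc s             ∎)
      where open ≤-Reasoning
    maxA : ∃[ I ] IndependentIn A I × IndependenceBound A (size I)
    maxA = maximum-independent A
    maxB : ∃[ I ] IndependentIn B I × IndependenceBound B (size I)
    maxB = maximum-independent B
    a₁ a₂ b₁ b₂ : ℕ
    a₁ = size (proj₁ maxA)
    a₂ = size (proj₁ maxB)
    b₁ = pred a₁
    b₂ = pred a₂
    positive : ∀ {m} → 1 ≤ m → m ≡ suc (pred m)
    positive (s≤s _) = refl
    a₁≡ : a₁ ≡ suc b₁
    a₁≡ = positive (independence-nonempty i∈A (proj₂ (proj₂ maxA)))
    a₂≡ : a₂ ≡ suc b₂
    a₂≡ = positive (independence-nonempty j∈B (proj₂ (proj₂ maxB)))
    exponents : suc (b₁ + b₂) ≤ b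
    exponents with independent-∪ A⊆U B⊆U anti (proj₁ (proj₂ maxA)) (proj₁ (proj₂ maxB))
    ... | ind , eq = s≤s⁻¹ (begin
      suc (suc (b₁ + b₂))   ≡⟨ cong suc (+-suc b₁ b₂) ⟨
      suc b₁ + suc b₂       ≡⟨ cong₂ _+_ a₁≡ a₂≡ ⟨
      a₁ + a₂               ≡⟨ eq ⟨
      _                     ≤⟨ indep _ ind ⟩
      suc b                 ∎)
      where open ≤-Reasoning
    Class : Fin (suc k) → (Fin n → ℕ) → Set
    Class j f = Supported U k f × weight A f ≡ Fin.toℕ j
    classify : ∀ {f} → Supported U k f → ∃[ j ] Class j f
    classify {f} sup = Fin.fromℕ< A≤k , sup , sym (Finₚ.toℕ-fromℕ< A≤k)
      where
      A≤k : weight A f < suc k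
      A≤k = s≤s (≤-trans (weight≤sum A f) (≤-reflexive (total sup)))
    split-weight : ∀ {f} → Supported U k f → ∀ S → weight S f ≡ weight S (f ⇂ A) + weight S (f ⇂ B)
    split-weight {f} sup S = trans (sum-cong-≗ pointwise) (weight-+ S (f ⇂ A) (f ⇂ B))
      where
      pointwise : ∀ i → (f ⇂ S) i ≡ ((λ i → (f ⇂ A) i + (f ⇂ B) i) ⇂ S) i
      pointwise i with A i in p | U i in u
      ... | true  | true  = cong (if S i then_else 0) (sym (+-identityʳ (f i)))
      ... | true  | false with () ← trans (sym u) (A⊆U i p)
      ... | false | true  = refl
      ... | false | false = cong (if S i then_else 0) (outside sup u)
    weight-B : ∀ {j f} → Class j f → weight B f ≡ k ∸ Fin.toℕ j
    weight-B {j} {f} (sup , eq) = begin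
      weight B f                               ≡⟨ m+n∸m≡n (weight A f) _ ⟨
      weight A f + weight B f ∸ weight A f     ≡⟨ cong₂ _∸_ (trans (sym (weight-split A⊆U f)) (supported-weight sup)) eq ⟩
      k ∸ Fin.toℕ j                            ∎
      where open ≡-Reasoning
    merge : ∀ {j f g} → Class j f → Class j g → Compatible (Fin.toℕ j) (f ⇂ A) (g ⇂ A) →
            Compatible (k ∸ Fin.toℕ j) (f ⇂ B) (g ⇂ B) → Compatible k f g
    merge {j} {f} {g} (supf , _) (supg , _) compatA compatB S T anti′ = begin
      weight S f + weight T g
        ≡⟨ cong₂ _+_ (split-weight supf S) (split-weight supg T) ⟩
      (weight S (f ⇂ A) + weight S (f ⇂ B)) + (weight T (g ⇂ A) + weight T (g ⇂ B))
        ≡⟨ interchange +-commutativeSemigroup (weight S (f ⇂ A)) _ _ _ ⟩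
      (weight S (f ⇂ A) + weight T (g ⇂ A)) + (weight S (f ⇂ B) + weight T (g ⇂ B))
        ≤⟨ +-mono-≤ (compatA S T anti′) (compatB S T anti′) ⟩
      Fin.toℕ j + (k ∸ Fin.toℕ j)
        ≡⟨ m+[n∸m]≡n (s≤s⁻¹ (Finₚ.toℕ<n j)) ⟩
      k ∎
      where open ≤-Reasoning
    cover-class : ∀ j → Cover (Compatible k) (Class j) (C * suc k ^ b₁ * (C * suc k ^ b₂))
    cover-class j = cover-≤
      (*-mono-≤ (*-monoʳ-≤ C (^-monoˡ-≤ b₁ (Finₚ.toℕ<n j))) (*-monoʳ-≤ C (^-monoˡ-≤ b₂ (s≤s (m∸n≤m k (Fin.toℕ j))))))
      (cover-× (_⇂ A) (_⇂ B)
        (λ { {f} (_ , eq) → subst (λ m → Supported A m (f ⇂ A)) eq (⇂-supported A f) })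
        (λ {f} p → subst (λ m → Supported B m (f ⇂ B)) (weight-B p) (⇂-supported B f))
        merge
        (bound A A≤s b₁ (≤-trans (≤-trans (m≤m+n b₁ b₂) (n≤1+n _)) (≤-trans exponents b≤n))
               (subst (IndependenceBound A) a₁≡ (proj₂ (proj₂ maxA))) (Fin.toℕ j))
        (bound B B≤s b₂ (≤-trans (≤-trans (m≤n+m b₂ b₁) (n≤1+n _)) (≤-trans exponents b≤n))
               (subst (IndependenceBound B) a₂≡ (proj₂ (proj₂ maxB))) (k ∸ Fin.toℕ j)))
    count : suc k * (C * suc k ^ b₁ * (C * suc k ^ b₂)) ≤ C * C * suc k ^ b
    count = begin
      suc k * (C * suc k ^ b₁ * (C * suc k ^ b₂))     ≡⟨ regroup (suc k) C (suc k ^ b₁) (suc k ^ b₂) ⟩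
      C * C * (suc k * (suc k ^ b₁ * suc k ^ b₂))     ≡⟨ cong (λ m → C * C * (suc k * m)) (^-distribˡ-+-* (suc k) b₁ b₂) ⟨
      C * C * suc k ^ suc (b₁ + b₂)                   ≤⟨ *-monoʳ-≤ (C * C) (^-monoʳ-≤ (suc k) exponents) ⟩
      C * C * suc k ^ b                               ∎
      where
      open ≤-Reasoning
      regroup : ∀ x c p q → x * (c * p * (c * q)) ≡ c * c * (x * (p * q))
      regroup = solve-∀

  -- A class fixes a vertex `w` with fewer than `M + M` pebbles, its level `r` and the deficit `t`
  -- of the residual total below `Q`; inside it the cover for `U` without `w` applies. The number of
  -- choices depends only on `n`. Of the `suc b` factors `suc Q`, one absorbs `M` and the others are
  -- bounded crudely, so the bound on `N * M` is free of `M`.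
  cover-level : ∀ {U C b k} → Connected U →
    (∀ {w} → U w ≡ true → ∀ K → Cover (Compatible K) (Supported (U ∖ ⁅ w ⁆) K) (C * suc K ^ suc b)) →
    ∀ {M} → 1 ≤ M → M ≤ k →
    ∃[ N ] Cover (Compatible k) (λ f → Dense U k M f × ∃[ w ] U w ≡ true × f w < M + M) N ×
           N * M ≤ n * (suc n * (suc (n + n) * (C * (((2 + n) * suc k) ^ b * ((2 + n) * suc k)))))
  cover-level {U} {C} {b} {k} conn cover-deleted {M} 1≤M M≤k =
    _ , cover-⊆ classify (cover-∃ λ w → cover-∃ λ r → cover-∃ λ t → cover-class w r t) , count
    where
    open ≤-Reasoning
    d Q X : ℕ
    -- Chosen so that the total rounding error, at most `n * d`, stays within `M`, while `M` is
    -- still less than `suc n` rounding units.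
    d = M / suc n
    -- The largest total the residual can have, since each vertex of `U` gives up `M` pebbles before
    -- rounding.
    Q = (k ∸ size U * M) / suc d
    X = (2 + n) * suc k
    open Rounding M d
    error≤M : size U * d ≤ M
    error≤M = begin
      size U * d     ≤⟨ *-monoˡ-≤ d (≤-trans (size-≤ U) (n≤1+n n)) ⟩
      suc n * d      ≡⟨ *-comm (suc n) d ⟩
      d * suc n      ≤⟨ m/n*n≤m M (suc n) ⟩
      M              ∎
    M<[1+n]δ : M < suc n * suc d
    M<[1+n]δ = begin-strict
      M                           ≡⟨ m≡m%n+[m/n]*n M (suc n) ⟩
      M % suc n + d * suc n       <⟨ +-monoˡ-< (d * suc n) (m%n<n M (suc n)) ⟩
      suc d * suc n               ≡⟨ *-comm (suc d) (suc n) ⟩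
      suc n * suc d               ∎
    Class : Fin n → Fin (suc n) → Fin (suc (n + n)) → (Fin n → ℕ) → Set
    Class w r t f = U w ≡ true × Dense U k M f × level f w ≡ Fin.toℕ r × sum (residual w f) ≡ Q ∸ Fin.toℕ t
    -- At most `M` pebbles remain at `w` after `M` are taken off, and these make fewer than `suc n`
    -- units.
    small-level : ∀ {f w} → f w < M + M → level f w < suc n
    small-level {f} {w} f<2M = m<n*o⇒m/o<n (≤-<-trans (begin
      f w ∸ M       ≤⟨ ∸-monoˡ-≤ M (<⇒≤ f<2M) ⟩
      M + M ∸ M     ≡⟨ m+n∸n≡m M M ⟩
      M             ∎) M<[1+n]δ)
    residual≤Q : ∀ {f} → Dense U k M f → ∀ w → sum (residual w f) ≤ Q
    residual≤Q {f} D w = begin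
      K                        ≡⟨ m*n/n≡m K (suc d) ⟨
      K * suc d / suc d        ≤⟨ /-monoˡ-≤ (suc d) (m+n≤o⇒m≤o∸n (K * suc d) (begin
        K * suc d + size U * M     ≡⟨ +-comm (K * suc d) _ ⟩
        size U * M + K * suc d     ≤⟨ +-monoʳ-≤ (size U * M)
                                        (≤-trans (≤-reflexive (*-comm K (suc d))) (*-monoʳ-≤ (suc d) (m≤m+n K _))) ⟩
        size U * M + suc d * (K + level f w) ≤⟨ lower-total D w ⟩
        k ∎)) ⟩
      Q                        ∎
      where
      K = sum (residual w f)
    -- The residual total falls short of `Q` by at most `n` units through rounding and at most `n`
    -- through the dropped level at `w`.
    Q-residual : ∀ {f w} → Dense U k M f → level f w < suc n → Q ∸ sum (residual w f) < suc (n + n)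
    Q-residual {f} {w} D l<1+n = s≤s (m≤n+o⇒m∸n≤o Q K (s≤s⁻¹ (m<n*o⇒m/o<n (s≤s (begin
      k ∸ size U * M
        ≤⟨ ∸-monoˡ-≤ (size U * M) (upper-total D w) ⟩
      size U * (M + d) + suc d * (K + level f w) ∸ size U * M
        ≡⟨ cong (_∸ size U * M) (expand (size U) M d (suc d * (K + level f w))) ⟩
      size U * M + (size U * d + suc d * (K + level f w)) ∸ size U * M
        ≡⟨ m+n∸m≡n (size U * M) _ ⟩
      size U * d + suc d * (K + level f w)
        ≤⟨ +-mono-≤ (*-mono-≤ (size-≤ U) (n≤1+n d)) (*-monoʳ-≤ (suc d) (+-monoʳ-≤ K (s≤s⁻¹ l<1+n))) ⟩
      n * suc d + suc d * (K + n)
        ≤⟨ m≤n+m _ d ⟩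
      d + (n * suc d + suc d * (K + n))
        ≡⟨ collect d n K ⟩
      d + (K + (n + n)) * suc d                 ∎)))))
      where
      K = sum (residual w f)
      expand : ∀ u m e x → u * (m + e) + x ≡ u * m + (u * e + x)
      expand = solve-∀
      collect : ∀ e m x → e + (m * suc e + suc e * (x + m)) ≡ e + (x + (m + m)) * suc e
      collect = solve-∀
    classify : ∀ {f} → Dense U k M f × (∃[ w ] U w ≡ true × f w < M + M) → ∃[ w ] ∃[ r ] ∃[ t ] Class w r t f
    classify {f} (D , w , w∈U , f<2M) =
      w , Fin.fromℕ< r< , Fin.fromℕ< t< , w∈U , D , sym (Finₚ.toℕ-fromℕ< r<)
        , sym (trans (cong (Q ∸_) (Finₚ.toℕ-fromℕ< t<)) (m∸[m∸n]≡n (residual≤Q D w)))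
      where
      r< : level f w < suc n
      r< = small-level {f} f<2M
      t< : Q ∸ sum (residual w f) < suc (n + n)
      t< = Q-residual D r<
    cover-class : ∀ w r t → Cover (Compatible k) (Class w r t) (C * suc Q ^ suc b)
    cover-class w r t with U w in w∈U
    ... | false = cover-empty λ { (() , _) }
    ... | true  = cover-≤ (*-monoʳ-≤ C (^-monoˡ-≤ (suc b) (s≤s (m∸n≤m Q (Fin.toℕ t)))))
      (cover-pullback (residual w)
        (λ { {f} (_ , D , _ , eq) →
             subst (λ m → Supported (U ∖ ⁅ w ⁆) m (residual w f)) eq (residual-supported {w = w} (support D)) })
        (λ { (_ , Df , rf , Kf) (_ , Dg , rg , _) →
             residual-reflects {w = w} conn error≤M Df Dg (trans rf (sym rg)) Kf })
        (cover-deleted w∈U (Q ∸ Fin.toℕ t)))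
    -- The extra `M` from `suc Q` is at most `k`, and `Q * M` is at most `suc n` times the
    -- `Q * suc d` pebbles counted by the levels.
    QM≤X : suc Q * M ≤ X
    QM≤X = begin
      M + Q * M                        ≤⟨ +-mono-≤ M≤k (*-monoʳ-≤ Q (<⇒≤ M<[1+n]δ)) ⟩
      k + Q * (suc n * suc d)          ≡⟨ cong (k +_) (rotate Q (suc n) (suc d)) ⟩
      k + suc n * (Q * suc d)          ≤⟨ +-monoʳ-≤ k (*-monoʳ-≤ (suc n) (≤-trans (m/n*n≤m (k ∸ size U * M) (suc d))
                                                                                  (m∸n≤m k (size U * M)))) ⟩
      (2 + n) * k                      ≤⟨ *-monoʳ-≤ (2 + n) (n≤1+n k) ⟩
      X                                ∎
      where
      rotate : ∀ x y z → x * (y * z) ≡ y * (x * z)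
      rotate = solve-∀
    Q≤X : suc Q ≤ X
    Q≤X = ≤-trans (≤-trans (≤-reflexive (sym (*-identityʳ (suc Q)))) (*-monoʳ-≤ (suc Q) 1≤M)) QM≤X
    count : n * (suc n * (suc (n + n) * (C * suc Q ^ suc b))) * M
            ≤ n * (suc n * (suc (n + n) * (C * (X ^ b * X))))
    count = begin
      n * (suc n * (suc (n + n) * (C * suc Q ^ suc b))) * M
        ≡⟨ regroup n (suc n) (suc (n + n)) C (suc Q) (suc Q ^ b) M ⟩
      n * (suc n * (suc (n + n) * (C * (suc Q ^ b * (suc Q * M)))))
        ≤⟨ *-monoʳ-≤ n (*-monoʳ-≤ (suc n) (*-monoʳ-≤ (suc (n + n)) (*-monoʳ-≤ C
             (*-mono-≤ (^-monoˡ-≤ b Q≤X) QM≤X)))) ⟩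
      n * (suc n * (suc (n + n) * (C * (X ^ b * X)))) ∎
      where
      regroup : ∀ x y z c q p m → x * (y * (z * (c * (q * p)))) * m ≡ x * (y * (z * (c * (p * (q * m)))))
      regroup = solve-∀


  levelConstant : ℕ → ℕ
  levelConstant C = n * (suc n * (suc (n + n) * (C * (2 + n) ^ n)))

  -- The scales `1, 2, 4, ...` sort configurations by their minimum on `U`. The vertex `i` rules out
  -- scales above `k`, and all scales together cost at most twice the bound of `cover-level`.
  cover-connected : ∀ {U C b k i} → U i ≡ true → Connected U → suc b ≤ n →
    (∀ {w} → U w ≡ true → ∀ K → Cover (Compatible K) (Supported (U ∖ ⁅ w ⁆) K) (C * suc K ^ suc b)) →
    Cover (Compatible k) (Dense U k 1) ((levelConstant C + levelConstant C) * suc k ^ suc b)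
  cover-connected {U} {C} {b} {k} {i} i∈U conn b<n cover-deleted =
    cover-≤ count (cover-dyadic {E = Dense U k} {k = k} empty step (cover-level {U} {C} {b} conn cover-deleted))
    where
    open ≤-Reasoning
    X Y : ℕ
    X = (2 + n) * suc k
    Y = n * (suc n * (suc (n + n) * (C * (X ^ b * X))))
    empty : ∀ {M f} → k < M → ¬ Dense U k M f
    empty {M} {f} k<M D = <⇒≱ k<M (begin
      M      ≤⟨ large D i i∈U ⟩
      f i    ≤⟨ term≤sum f i ⟩
      sum f  ≡⟨ total (support D) ⟩
      k      ∎)
    step : ∀ {M f} → Dense U k M f → (Dense U k M f × ∃[ w ] U w ≡ true × f w < M + M) ⊎ Dense U k (M + M) f
    step {M} {f} D with Finₚ.any? (λ w → (U w Data.Bool.≟ true) ×-dec (f w <? M + M))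
    ... | yes found = inj₁ (D , found)
    ... | no none   = inj₂ (dense (support D) λ w w∈U → ≮⇒≥ λ f< → none (w , w∈U , f<))
    X^ : X ^ b * X ≤ (2 + n) ^ n * suc k ^ suc b
    X^ = begin
      X ^ b * X                              ≡⟨ *-comm (X ^ b) X ⟩
      X ^ suc b                              ≡⟨ ^-distribʳ-* (suc b) (2 + n) (suc k) ⟩
      (2 + n) ^ suc b * suc k ^ suc b        ≤⟨ *-monoˡ-≤ (suc k ^ suc b) (^-monoʳ-≤ (2 + n) b<n) ⟩
      (2 + n) ^ n * suc k ^ suc b            ∎
    Y≤ : Y ≤ levelConstant C * suc k ^ suc b
    Y≤ = begin
      Y
        ≤⟨ *-monoʳ-≤ n (*-monoʳ-≤ (suc n) (*-monoʳ-≤ (suc (n + n)) (*-monoʳ-≤ C X^))) ⟩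
      n * (suc n * (suc (n + n) * (C * ((2 + n) ^ n * suc k ^ suc b))))
        ≡⟨ regroup n (suc n) (suc (n + n)) C ((2 + n) ^ n) (suc k ^ suc b) ⟩
      levelConstant C * suc k ^ suc b ∎
      where
      regroup : ∀ x y z c p q → x * (y * (z * (c * (p * q)))) ≡ x * (y * (z * (c * p))) * q
      regroup = solve-∀
    count : Y + Y ≤ (levelConstant C + levelConstant C) * suc k ^ suc b
    count = begin
      Y + Y                                                                    ≤⟨ +-mono-≤ Y≤ Y≤ ⟩
      levelConstant C * suc k ^ suc b + levelConstant C * suc k ^ suc b
        ≡⟨ *-distribʳ-+ (suc k ^ suc b) (levelConstant C) _ ⟨
      (levelConstant C + levelConstant C) * suc k ^ suc b                      ∎

  -- The summand `n * C` pays for configurations vanishing at some vertex of `U`; `1`, `C * C` and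
  -- the doubled `levelConstant` pay for the clique, split and connected cases, added up in place of
  -- a maximum.
  nextConstant : ℕ → ℕ
  nextConstant C = n * C + (1 + C * C + (levelConstant C + levelConstant C))

  cover-step : ∀ {s C} → CoverBound s C → CoverBound (suc s) (nextConstant C)
  cover-step {s} {C} bound U U≤ b b≤n indep k =
    cover-≤ (≤-reflexive count) (cover-⊆ classify (cover-⊎ (cover-∃ cover-vanishing) cover-positive))
    where
    D : ℕ
    D = levelConstant C + levelConstant C
    P : ℕ
    P = suc k ^ b
    1≤P : 1 ≤ P
    1≤P = m^n>0 (suc k) b
    Vanishing : Fin n → (Fin n → ℕ) → Set
    Vanishing w f = U w ≡ true × Supported (U ∖ ⁅ w ⁆) k f
    classify : ∀ {f} → Supported U k f → ∃ (λ w → Vanishing w f) ⊎ Dense U k 1 f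
    classify {f} sup with Finₚ.any? (λ w → (U w Data.Bool.≟ true) ×-dec (f w ≟ 0))
    ... | no none = inj₂ (dense sup λ w w∈U → n≢0⇒n>0 λ fw≡0 → none (w , w∈U , fw≡0))
    ... | yes (w , w∈U , fw≡0) = inj₁ (w , w∈U , supported out (total sup))
      where
      out : ∀ {i} → (U ∖ ⁅ w ⁆) i ≡ false → f i ≡ 0
      out {i} i∉ with U i in u | w Fin.≟ i
      ... | false | _        = outside sup u
      ... | true  | yes refl = fw≡0
    deleted : ∀ {w} → U w ≡ true → ∀ K → Cover (Compatible K) (Supported (U ∖ ⁅ w ⁆) K) (C * suc K ^ b)
    deleted {w} w∈U K = bound (U ∖ ⁅ w ⁆) smaller b b≤n
      (λ I (ind , I⊆) → indep I (ind , λ i i∈I → proj₁ (∧-true {U i} (I⊆ i i∈I)))) K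
      where
      open ≤-Reasoning
      smaller : size (U ∖ ⁅ w ⁆) ≤ s
      smaller = s≤s⁻¹ (begin
        1 + size (U ∖ ⁅ w ⁆)             ≡⟨ cong (_+ size (U ∖ ⁅ w ⁆)) (weight-⁅⁆ w (const 1)) ⟨
        size ⁅ w ⁆ + size (U ∖ ⁅ w ⁆)    ≡⟨ weight-split (⁅⁆⊆ {U = U} w∈U) (const 1) ⟨
        size U                           ≤⟨ U≤ ⟩
        suc s                            ∎)
    cover-vanishing : ∀ w → Cover (Compatible k) (Vanishing w) (C * P)
    cover-vanishing w with U w in w∈U
    ... | false = cover-empty λ { (() , _) }
    ... | true  = cover-⊆ proj₂ (deleted w∈U k)
    cover-positive : Cover (Compatible k) (Dense U k 1) ((1 + C * C + D) * P)
    cover-positive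
      with Finₚ.any? (λ i → Finₚ.any? (λ j → (U i Data.Bool.≟ true) ×-dec (U j Data.Bool.≟ true) ×-dec ¬? (R? i j)))
    ... | no complete = cover-≤ (*-mono-≤ {1} {1 + C * C + D} {1} {P} (s≤s z≤n) 1≤P)
                                (cover-clique λ Df Dg → clique-compatible clique (support Df) (support Dg))
      where
      clique : ∀ i j → U i ≡ true → U j ≡ true → R i j
      clique i j i∈U j∈U with R? i j
      ... | yes Rij = Rij
      ... | no ¬Rij = contradiction (i , j , i∈U , j∈U , ¬Rij) complete
    ... | yes (i , j , i∈U , j∈U , ¬Rij) with split-or-connected U
    ...   | inj₁ splitU = cover-≤ {M = C * C * P} (*-monoˡ-≤ P (≤-trans (n≤1+n (C * C)) (m≤m+n (1 + C * C) D)))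
                                 (cover-⊆ support (cover-split {C = C} bound U≤ b b≤n indep splitU k))
    -- The unrelated pair `i`, `j` forces `1 ≤ b`, which supplies the factor that `cover-level`
    -- spends on absorbing `M`.
    ...   | inj₂ conn with s≤s⁻¹ (independent-pair i∈U j∈U ¬Rij indep)
    ...     | s≤s {n = b′} z≤n = cover-≤ (*-monoˡ-≤ P (m≤n+m D (1 + C * C)))
                                       (cover-connected {U} {C} {b′} i∈U conn b≤n deleted)
    count : n * (C * P) + (1 + C * C + D) * P ≡ nextConstant C * P
    count = begin
      n * (C * P) + (1 + C * C + D) * P    ≡⟨ cong (_+ (1 + C * C + D) * P) (*-assoc n C P) ⟨
      n * C * P + (1 + C * C + D) * P      ≡⟨ *-distribʳ-+ P (n * C) (1 + C * C + D) ⟨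
      nextConstant C * P                   ∎
      where open ≡-Reasoning

  cover-bound : ∀ s → ∃[ C ] CoverBound s C
  cover-bound zero = 1 , λ U U≤0 b _ _ k →
    cover-≤ (*-mono-≤ {1} ≤-refl (m^n>0 (suc k) b))
            (cover-clique (clique-compatible λ i _ i∈U _ → contradiction (≤-trans (nonempty⇒size U i∈U) U≤0) λ ()))
  cover-bound (suc s) with cover-bound s
  ... | C , bound = nextConstant C , cover-step bound

-- Configurations of pebbles on a graph

members : (S : Subset n) → Fin ∣ S ∣ → Fin n
members (true  ∷ S) zero    = zero
members (true  ∷ S) (suc i) = suc (members S i)
members (false ∷ S) i       = suc (members S i)

members-∈ : (S : Subset n) → ∀ i → members S i ∈ S
members-∈ (true  ∷ S) zero    = here
members-∈ (true  ∷ S) (suc i) = there (members-∈ S i)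
members-∈ (false ∷ S) i       = there (members-∈ S i)

members-injective : (S : Subset n) → ∀ {i j} → members S i ≡ members S j → i ≡ j
members-injective (true  ∷ S) {zero}  {zero}  _  = refl
members-injective (true  ∷ S) {suc i} {suc j} eq = cong suc (members-injective S (Finₚ.suc-injective eq))
members-injective (false ∷ S) eq = members-injective S (Finₚ.suc-injective eq)

injective-on-∈⇒∣∣≤ : ∀ {N} (S : Subset n) (h : Fin n → Fin N) →
                     (∀ {x y} → x ∈ S → y ∈ S → h x ≡ h y → x ≡ y) → ∣ S ∣ ≤ N
injective-on-∈⇒∣∣≤ S h inj =
  Finₚ.injective⇒≤ {f = h ∘ members S} λ {i} {j} eq → members-injective S (inj (members-∈ S i) (members-∈ S j) eq)

∣tabulate∣ : (I : Fin n → Bool) → ∣ tabulate I ∣ ≡ size I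
∣tabulate∣ {zero}  I = refl
∣tabulate∣ {suc n} I with I zero
... | true  = cong suc (∣tabulate∣ (I ∘ suc))
... | false = ∣tabulate∣ (I ∘ suc)

∈-tabulate⁻ : (I : Fin n → Bool) → ∀ {i} → i ∈ tabulate I → I i ≡ true
∈-tabulate⁻ I {i} i∈ = trans (sym (lookup∘tabulate I i)) ([]=⇒lookup i∈)

sum-lookup : (xs : Vec ℕ n) → sum (lookup xs) ≡ Vec.sum xs
sum-lookup []       = refl
sum-lookup (x ∷ xs) = cong (x +_) (sum-lookup xs)

-- From covers to the independence number of `G [ k ]`

module _ (G : Graph) where
  open Graph G hiding (_≟_)

  Near : Fin order → Fin order → Set
  Near i j = vertex i ≡ vertex j ⊎ vertex i ~ vertex j

  near? : ∀ i j → Dec (Near i j)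
  near? i j = (vertex i ≟ᵛ vertex j) ⊎-dec (vertex i ~? vertex j)
    where open Graph G using () renaming (_≟_ to _≟ᵛ_)

  near-sym : ∀ {i j} → Near i j → Near j i
  near-sym (inj₁ eq) = inj₁ (sym eq)
  near-sym (inj₂ i~j) = inj₂ (~-sym i~j)

  open Confusability Near near? (inj₁ refl) near-sym

  index-vertex : ∀ i → index (vertex i) ≡ i
  index-vertex = Inverse.strictlyInverseˡ enumeration

  fibreSize-vertex : ∀ {k} (φ : Fin k → Fin order) v → fibreSize G (vertex ∘ φ) v ≡ occurrences φ (index v)
  fibreSize-vertex {zero}  φ v = refl
  fibreSize-vertex {suc k} φ v rewrite index-vertex (φ zero) with φ zero Fin.≟ index v
  ... | yes _ = cong suc (fibreSize-vertex (φ ∘ suc) v)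
  ... | no _  = fibreSize-vertex (φ ∘ suc) v

  config-supported : ∀ {k} (f : Config order k) → Supported (const true) k (lookup (proj₁ f))
  config-supported (f , p) = supported (λ ()) (trans (sum-lookup f) p)

  compatible⇒reachable : ∀ {k} (f g : Config order k) →
                         Compatible k (lookup (proj₁ f)) (lookup (proj₁ g)) → Reachable G f g
  compatible⇒reachable f g compat
    with hall _ (total (config-supported f)) (total (config-supported g)) compat
  ... | φ , γ , φf , γg , near =
    vertex ∘ φ , vertex ∘ γ
    , (λ v → trans (fibreSize-vertex φ v) (φf (index v)))
    , (λ v → trans (fibreSize-vertex γ v) (γg (index v)))
    , near

  α≤order : α G ≤ order
  α≤order with α-attained G
  ... | S , _ , eq = ≤-trans (≤-reflexive (sym eq)) (∣p∣≤n S)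

  -- The subtraction is truncated: for a graph without vertices `suc (α G ∸ 1)` is 1 rather than
  -- `α G`, which is still an upper bound.
  independence-bound : IndependenceBound (const true) (suc (α G ∸ 1))
  independence-bound I (ind , _) = begin
    size I              ≡⟨ ∣tabulate∣ I ⟨
    ∣ tabulate I ∣      ≤⟨ α-upper G independent ⟩
    α G                 ≤⟨ m≤n+m∸n (α G) 1 ⟩
    suc (α G ∸ 1)       ∎
    where
    open ≤-Reasoning
    independent : Defs.Independent G (tabulate I)
    independent i j i∈ j∈ i~j with ind (∈-tabulate⁻ I i∈) (∈-tabulate⁻ I j∈) (inj₂ i~j)
    ... | refl = ~-irrefl i~j

  -- Pigeonhole: distinct configurations with the same key are compatible, hence adjacent by Hall's
  -- theorem, so an independent set has at most one element per key.
  α[]≤ : ∀ {k N} → Cover (Compatible k) (Supported (const true) k) N → α (G [ k ]) ≤ N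
  α[]≤ {k} {N} c with α-attained (G [ k ])
  ... | S , ind , eq = subst (_≤ N) eq (injective-on-∈⇒∣∣≤ S (λ x → key c (config-supported (config x))) injective)
    where
    config : Fin (Graph.order (G [ k ])) → Config order k
    config = Graph.vertex (G [ k ])
    injective : ∀ {x y} → x ∈ S → y ∈ S →
                key c (config-supported (config x)) ≡ key c (config-supported (config y)) → x ≡ y
    injective {x} {y} x∈S y∈S same with x Fin.≟ y
    ... | yes x≡y = x≡y
    ... | no x≢y = contradiction
      ( (λ fx≡fy → x≢y (trans (sym (Inverse.strictlyInverseˡ (Graph.enumeration (G [ k ])) x))
                       (trans (cong (Graph.index (G [ k ])) fx≡fy)
                              (Inverse.strictlyInverseˡ (Graph.enumeration (G [ k ])) y))))
      , compatible⇒reachable (config x) (config y)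
          (key-≈ c (config-supported (config x)) (config-supported (config y)) same))
      (ind x y x∈S y∈S)

  α[]-bound : ∀ C → CoverBound order C → ∀ k → 1 ≤ k → α (G [ k ]) ≤ C * 2 ^ (α G ∸ 1) * k ^ (α G ∸ 1)
  α[]-bound C bound k 1≤k =
    ≤-trans (α[]≤ (bound (const true) (size-≤ (const true)) (α G ∸ 1) b≤n independence-bound k)) (count (α G ∸ 1))
    where
    open ≤-Reasoning
    b≤n : α G ∸ 1 ≤ order
    b≤n = ≤-trans (m∸n≤m (α G) 1) α≤order
    count : ∀ b → C * suc k ^ b ≤ C * 2 ^ b * k ^ b
    count b = begin
      -- For `1 ≤ k` one has `suc k ≤ 2 * k`, which trades `suc k` for `k` at the cost of the factor
      -- `2 ^ b`.
      C * suc k ^ b           ≤⟨ *-monoʳ-≤ C (^-monoˡ-≤ b (+-mono-≤ 1≤k (≤-reflexive (sym (+-identityʳ k))))) ⟩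
      C * (2 * k) ^ b         ≡⟨ cong (C *_) (^-distribʳ-* b 2 k) ⟩
      C * (2 ^ b * k ^ b)     ≡⟨ *-assoc C (2 ^ b) (k ^ b) ⟨
      C * 2 ^ b * k ^ b       ∎

  cover-order : ∃[ C ] CoverBound order C
  cover-order = cover-bound order

theorem2 : (G : Graph) → ∃[ C ] (∀ (k : ℕ) → 1 ≤ k → α (G [ k ]) ≤ C * k ^ (α G ∸ 1))
theorem2 G = proj₁ (cover-order G) * 2 ^ (α G ∸ 1) , α[]-bound G (proj₁ (cover-order G)) (proj₂ (cover-order G))
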